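{- Let $G$ and $H$ be nontrivial connected graphs such that at least one of $G$ or $H$ has no isolatable vertices. The direct product $G \times H$ is well-dominated if and only if (up to isomorphism) $G=H=K_3$, or at least one of the factors $G,H$ is $K_2$ and the other factor is a $4$-cycle or the corona of a connected graph.
   Context: All graphs are finite and simple. A graph is nontrivial if it has at least $2$ vertices. For $S\subseteq V(G)$, $N[S]$ denotes the closed neighborhood of $S$ (all vertices in $S$ or adjacent to a vertex of $S$). A vertex $x$ of $G$ is isolatable if there is an independent set $I$ (possibly empty) in $G$ such that $x$ is an isolated vertex in $G-N[I]$. A set $D\subseteq V(G)$ is a dominating set if $N[D]=V(G)$. A graph is well-dominated if all of its minimal (with respect to inclusion) dominating sets have the same cardinality. The direct product $G\times H$ has vertex set $V(G)\times V(H)$, and $(g_1,h_1)$, $(g_2,h_2)$ are adjacent iff $g_1g_2\in E(G)$ and $h_1h_2\in E(H)$. The corona $F\circ K_1$ of a graph $F$ is formed from $F$ by adding, for each vertex of $F$, a single new vertex of degree $1$ adjacent to it. $K_n$ is the complete graph on $n$ vertices. -}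

module Defs where

open import Data.Empty using (⊥)
open import Data.Fin using (Fin; toℕ; splitAt; quotient; remainder)
open import Data.Fin.Properties using (_≟_; all?)
open import Data.Fin.Subset using (Subset; _∈_; _⊂_; ∣_∣)
open import Data.Nat using (ℕ; suc; _+_; _*_; _≤_; _%_)
import Data.Nat.Properties as ℕ
open import Data.Product using (∃-syntax; _×_; _,_)
open import Data.Sum using (_⊎_; inj₁; inj₂; swap)
open import Function using (_on_)
open import Function.Bundles using (_↔_; _⇔_; Inverse)
open import Level using (0ℓ)
open import Relation.Binary using (Rel; Decidable; Symmetric)
open import Relation.Binary.Construct.Closure.ReflexiveTransitive using (Star)
open import Relation.Binary.PropositionalEquality
  using (_≡_; _≢_; refl; sym; ≢-sym)
open import Relation.Nullary using (¬_; no; ¬?; _×-dec_; _⊎-dec_)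
open import Relation.Nullary.Decidable using (from-yes)
open import Relation.Unary using (Pred; ∁)

-- Finite simple graphs.  Decidability of adjacency is automatic
-- classically for a finite graph; here it has to be part of the data.

record Graph : Set₁ where
  field
    order  : ℕ
    Adj    : Rel (Fin order) 0ℓ
    adj?   : Decidable Adj
    symm   : Symmetric Adj
    irrefl : ∀ {x} → ¬ Adj x x

  Vertex : Set
  Vertex = Fin order

  VertexSet : Set
  VertexSet = Subset order

open Graph using (order; Vertex; VertexSet)

record _≅_ (G H : Graph) : Set where
  field
    bijection : Vertex G ↔ Vertex H

  open Inverse bijection public using (to; from)

  field
    adjacency : ∀ x y → Graph.Adj G x y ⇔ Graph.Adj H (to x) (to y)

infix 4 _≅_

module _ (G : Graph) where
  open Graph G using (Adj)

  Nontrivial : Set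
  Nontrivial = 2 ≤ order G

  Connected : Set
  Connected = ∀ (x y : Vertex G) → Star Adj x y

  N[_] : VertexSet G → Pred (Vertex G) 0ℓ
  N[ S ] x = x ∈ S ⊎ (∃[ y ] y ∈ S × Adj x y)

  Independent : VertexSet G → Set
  Independent I = ∀ {x y} → x ∈ I → y ∈ I → ¬ Adj x y

  -- x is an isolated vertex of the subgraph induced by W.
  IsolatedIn : Pred (Vertex G) 0ℓ → Vertex G → Set
  IsolatedIn W x = W x × (∀ y → W y → ¬ Adj x y)

  Isolatable : Vertex G → Set
  Isolatable x = ∃[ I ] Independent I × IsolatedIn (∁ N[ I ]) x

  NoIsolatableVertices : Set
  NoIsolatableVertices = ∀ x → ¬ Isolatable x

  Dominating : VertexSet G → Set
  Dominating D = ∀ x → N[ D ] x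

  MinimalDominating : VertexSet G → Set
  MinimalDominating D = Dominating D × (∀ D′ → D′ ⊂ D → ¬ Dominating D′)

  WellDominated : Set
  WellDominated =
    ∀ D D′ → MinimalDominating D → MinimalDominating D′ → ∣ D ∣ ≡ ∣ D′ ∣

-- The vertex set V(G) × V(H) is encoded as Fin (order G * order H) along
-- the bijection i ↦ (quotient i , remainder i), whose inverse is
-- Data.Fin.combine.

infixr 7 _×ᴳ_

_×ᴳ_ : Graph → Graph → Graph
G ×ᴳ H = record
  { order  = order G * order H
  ; Adj    = λ i j → G.Adj (fst i) (fst j) × H.Adj (snd i) (snd j)
  ; adj?   = λ i j → G.adj? (fst i) (fst j) ×-dec H.adj? (snd i) (snd j)
  ; symm   = λ (p , q) → G.symm p , H.symm q
  ; irrefl = λ (p , _) → G.irrefl p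
  }
  where
  module G = Graph G
  module H = Graph H

  fst : Fin (order G * order H) → Vertex G
  fst = quotient (order H)

  snd : Fin (order G * order H) → Vertex H
  snd = remainder {order G} (order H)

K : ℕ → Graph
K n = record
  { order  = n
  ; Adj    = _≢_
  ; adj?   = λ x y → ¬? (x ≟ y)
  ; symm   = ≢-sym
  ; irrefl = λ x≢x → x≢x refl
  }

C₄ : Graph
C₄ = record
  { order  = 4
  ; Adj    = λ x y → Next x y ⊎ Next y x
  ; adj?   = adj?
  ; symm   = swap
  ; irrefl = λ {x} → from-yes (all? (λ x → ¬? (adj? x x))) x
  }
  where
  Next : Rel (Fin 4) 0ℓ
  Next x y = toℕ y ≡ suc (toℕ x) % 4

  next? : Decidable Next
  next? x y = toℕ y ℕ.≟ suc (toℕ x) % 4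

  adj? : Decidable (λ x y → Next x y ⊎ Next y x)
  adj? x y = next? x y ⊎-dec next? y x

-- In F ∘ K₁, inj₁ x is the vertex x of F and inj₂ x is the new vertex of
-- degree 1 attached to x.

module _ (F : Graph) where
  private module F = Graph F

  CoronaAdj : Rel (Vertex F ⊎ Vertex F) 0ℓ
  CoronaAdj (inj₁ x) (inj₁ y) = F.Adj x y
  CoronaAdj (inj₁ x) (inj₂ y) = x ≡ y
  CoronaAdj (inj₂ x) (inj₁ y) = x ≡ y
  CoronaAdj (inj₂ x) (inj₂ y) = ⊥

  coronaAdj? : Decidable CoronaAdj
  coronaAdj? (inj₁ x) (inj₁ y) = F.adj? x y
  coronaAdj? (inj₁ x) (inj₂ y) = x ≟ y
  coronaAdj? (inj₂ x) (inj₁ y) = x ≟ y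
  coronaAdj? (inj₂ x) (inj₂ y) = no λ ()

  coronaAdj-symm : Symmetric CoronaAdj
  coronaAdj-symm {inj₁ x} {inj₁ y} p = F.symm p
  coronaAdj-symm {inj₁ x} {inj₂ y} p = sym p
  coronaAdj-symm {inj₂ x} {inj₁ y} p = sym p

  coronaAdj-irrefl : ∀ s → ¬ CoronaAdj s s
  coronaAdj-irrefl (inj₁ x) = F.irrefl

  corona : Graph
  corona = record
    { order  = order F + order F
    ; Adj    = CoronaAdj on splitAt (order F)
    ; adj?   = λ i j → coronaAdj? (splitAt (order F) i) (splitAt (order F) j)
    ; symm   = λ {i} {j} →
        coronaAdj-symm {splitAt (order F) i} {splitAt (order F) j}
    ; irrefl = λ {i} → coronaAdj-irrefl (splitAt (order F) i)
    }

FourCycleOrCorona : Graph → Set₁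
FourCycleOrCorona G = G ≅ C₄ ⊎ (∃[ F ] Connected F × G ≅ corona F)

-- In a well-dominated graph |I| ≤ |D| whenever I is independent and D is
-- dominating.  Suppose G × H is well-dominated and G has no isolatable vertices.
-- Comparing sets built from single vertices of G and a maximal independent set
-- of H shows that adjacency in G is transitive, so G is complete.  Every fibre
-- {c} × H is then independent and dominating, and local exchanges in it give:
-- if p has neighbours a ≠ b in H, then N(k) ⊆ {a , b} for some k, with k ≠ p if
-- G = K₂.  If G has at least three vertices, then H has no leaves and all its
-- degrees are two, and further exchanges force H = K₃ and |G| = 3.  If G = K₂, a
-- leaf of H makes all neighbours of its support (other than itself) supports
-- again, so H is a corona; without leaves H is a 4-cycle.
-- Conversely, K₃ × K₃ and K₂ × C₄ are checked by enumeration, and for a corona H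
-- a minimal dominating set of K₂ × H meets each pendant edge exactly once.

module Submission where

open import Defs
import Algebra.Properties.CommutativeMonoid.Sum as Sum-of
open import Data.Bool using (Bool; true; false; if_then_else_)
open import Data.Empty using (⊥-elim)
open import Data.Fin
  using (Fin; zero; suc; combine; inject≤; join; quotient; remainder; remQuot; splitAt)
open import Data.Fin.Patterns
open import Data.Fin.Properties
  using (_≟_; all?; any?; ¬∀⟶∃¬; *↔×; combine-injective; combine-remQuot;
         inject≤-injective; join-splitAt; remQuot-combine; splitAt-join)
open import Data.Fin.Subset
  using (Subset; _∈_; _∉_; _⊆_; _⊂_; ∣_∣; _∪_; _∩_; _-_; ⁅_⁆; ⊥; inside; outside)
open import Data.Fin.Subset.Induction using (Acc; acc; ⊂-wellFounded; ⊃-wellFounded)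
open import Data.Fin.Subset.Properties
  using (_∈?_; anySubset?; ⊆-refl; ⊆-trans; p⊆p∪q; p─q⊆p; p⊆q⇒∣p∣≤∣q∣; p⊂q⇒∣p∣<∣q∣;
         ∉⊥; ∣⊥∣≡0; ∣⁅x⁆∣≡1; x∈⁅x⁆; x∈⁅y⁆⇒x≡y; x∈p∩q⁺; x∈p∩q⁻; x∈p∪q⁺; x∈p∪q⁻;
         x∈p∧x≢y⇒x∈p-y; x∈p⇒p-x⊂p)
open import Data.List
  using (List; []; _∷_; allFin; cartesianProductWith; filter; length; lookup; map)
import Data.List.Membership.DecPropositional as DecMembership
import Data.List.Membership.Propositional as List
open import Data.List.Membership.Propositional.Properties
  using (∈-allFin; ∈-cartesianProductWith⁻; ∈-filter⁺; ∈-filter⁻; ∈-lookup; ∈-map⁺; ∈-map⁻)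
open import Data.List.Properties using (length-++; length-map)
open import Data.List.Relation.Unary.All as All using ([]; _∷_)
open import Data.List.Relation.Unary.AllPairs using ([]; _∷_)
open import Data.List.Relation.Unary.Any as Any using (here; there)
open import Data.List.Relation.Unary.Any.Properties using (lookup-index)
open import Data.List.Relation.Unary.Unique.Propositional using (Unique)
open import Data.List.Relation.Unary.Unique.Propositional.Properties
  using (allFin⁺; cartesianProductWith⁺; filter⁺)
open import Data.Nat using (ℕ; zero; suc; _+_; _*_; _≤_; _<_; z≤n; s≤s)
import Data.Nat.Properties as ℕ
open import Data.Product as Product using (∃-syntax; ∃₂; _×_; _,_; proj₁; proj₂; uncurry)
open import Data.Product.Function.NonDependent.Propositional using (_×-↔_)
open import Data.Sum as Sum using (_⊎_; inj₁; inj₂; [_,_]′)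
open import Data.Sum.Properties using (swap-involutive)
open import Data.Vec as Vec using ([]; _∷_)
open import Data.Vec.Properties using ([]=⇒lookup; lookup⇒[]=; lookup∘tabulate; tabulate∘lookup)
open import Function using (_∘_; id; case_of_)
open import Function.Bundles using (_⇔_; _↔_; mk⇔; mk↔ₛ′; Equivalence; Inverse)
open import Function.Properties.Inverse using (↔-sym; ↔-trans)
open import Level using (0ℓ)
open import Relation.Binary.Construct.Closure.ReflexiveTransitive using (Star; ε; _◅_)
open import Relation.Binary.PropositionalEquality
  using (_≡_; _≢_; refl; sym; trans; cong; cong₂; subst; subst₂; ≢-sym; module ≡-Reasoning)
open import Relation.Nullary
  using (Dec; yes; no; does; ¬_; ¬?; _×-dec_; _⊎-dec_; _→-dec_)
open import Relation.Nullary.Decidable using (dec-true; decidable-stable; from-no)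
open import Relation.Unary using (Pred; Decidable)

open Graph using (order; Vertex; VertexSet)
open Sum-of ℕ.+-0-commutativeMonoid using (sum; sum-permute; ∑-distrib-+)

-- Subsets cut out by decidable predicates or listed by their elements, and their sizes.

⟪_⟫ : ∀ {n} {P : Pred (Fin n) 0ℓ} → Decidable P → Subset n
⟪ P? ⟫ = Vec.tabulate (does ∘ P?)

module _ {n} {P : Pred (Fin n) 0ℓ} (P? : Decidable P) where

  ∈⟪⟫⁺ : ∀ {x} → P x → x ∈ ⟪ P? ⟫
  ∈⟪⟫⁺ {x} px =
    lookup⇒[]= x _ (trans (lookup∘tabulate _ x) (dec-true (P? x) px))

  ∈⟪⟫⁻ : ∀ {x} → x ∈ ⟪ P? ⟫ → P x
  ∈⟪⟫⁻ {x} x∈ with P? x | trans (sym (lookup∘tabulate (does ∘ P?) x)) ([]=⇒lookup x∈)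
  ... | yes px | _  = px
  ... | no _   | ()

-- Inclusion-exclusion in additive form, which avoids truncated subtraction.
∣p∣+∣q∣≡∣p∪q∣+∣p∩q∣ : ∀ {n} (p q : Subset n) → ∣ p ∣ + ∣ q ∣ ≡ ∣ p ∪ q ∣ + ∣ p ∩ q ∣
∣p∣+∣q∣≡∣p∪q∣+∣p∩q∣ []            []            = refl
∣p∣+∣q∣≡∣p∪q∣+∣p∩q∣ (inside  ∷ p) (inside  ∷ q) = cong suc
  (trans (ℕ.+-suc ∣ p ∣ ∣ q ∣)
  (trans (cong suc (∣p∣+∣q∣≡∣p∪q∣+∣p∩q∣ p q)) (sym (ℕ.+-suc ∣ p ∪ q ∣ ∣ p ∩ q ∣))))
∣p∣+∣q∣≡∣p∪q∣+∣p∩q∣ (inside  ∷ p) (outside ∷ q) = cong suc (∣p∣+∣q∣≡∣p∪q∣+∣p∩q∣ p q)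
∣p∣+∣q∣≡∣p∪q∣+∣p∩q∣ (outside ∷ p) (inside  ∷ q) =
  trans (ℕ.+-suc ∣ p ∣ ∣ q ∣) (cong suc (∣p∣+∣q∣≡∣p∪q∣+∣p∩q∣ p q))
∣p∣+∣q∣≡∣p∪q∣+∣p∩q∣ (outside ∷ p) (outside ∷ q) = ∣p∣+∣q∣≡∣p∪q∣+∣p∩q∣ p q

∣p∣≤∣q∣+∣r∣ : ∀ {n} {p q r : Subset n} →
  (∀ {x} → x ∈ p → x ∈ q ⊎ x ∈ r) → ∣ p ∣ ≤ ∣ q ∣ + ∣ r ∣
∣p∣≤∣q∣+∣r∣ {p = p} {q} {r} p⊆ = begin
  ∣ p ∣                   ≤⟨ p⊆q⇒∣p∣≤∣q∣ (x∈p∪q⁺ ∘ p⊆) ⟩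
  ∣ q ∪ r ∣               ≤⟨ ℕ.m≤m+n _ _ ⟩
  ∣ q ∪ r ∣ + ∣ q ∩ r ∣   ≡⟨ ∣p∣+∣q∣≡∣p∪q∣+∣p∩q∣ q r ⟨
  ∣ q ∣ + ∣ r ∣           ∎
  where open ℕ.≤-Reasoning

∣p∩q∣≡0 : ∀ {n} (p q : Subset n) → (∀ {x} → x ∈ p → x ∉ q) → ∣ p ∩ q ∣ ≡ 0
∣p∩q∣≡0 []            []            disj = refl
∣p∩q∣≡0 (inside  ∷ p) (inside  ∷ q) disj = ⊥-elim (disj Vec.here Vec.here)
∣p∩q∣≡0 (inside  ∷ p) (outside ∷ q) disj = ∣p∩q∣≡0 p q λ x∈p x∈q → disj (Vec.there x∈p) (Vec.there x∈q)
∣p∩q∣≡0 (outside ∷ p) (_       ∷ q) disj = ∣p∩q∣≡0 p q λ x∈p x∈q → disj (Vec.there x∈p) (Vec.there x∈q)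

∣p∣+∣q∣≤∣r∣ : ∀ {n} {p q r : Subset n} → p ⊆ r → q ⊆ r →
  (∀ {x} → x ∈ p → x ∉ q) → ∣ p ∣ + ∣ q ∣ ≤ ∣ r ∣
∣p∣+∣q∣≤∣r∣ {p = p} {q} {r} p⊆r q⊆r disj = begin
  ∣ p ∣ + ∣ q ∣           ≡⟨ ∣p∣+∣q∣≡∣p∪q∣+∣p∩q∣ p q ⟩
  ∣ p ∪ q ∣ + ∣ p ∩ q ∣   ≡⟨ cong (∣ p ∪ q ∣ +_) (∣p∩q∣≡0 p q disj) ⟩
  ∣ p ∪ q ∣ + 0           ≡⟨ ℕ.+-identityʳ _ ⟩
  ∣ p ∪ q ∣               ≤⟨ p⊆q⇒∣p∣≤∣q∣ ([ p⊆r , q⊆r ]′ ∘ x∈p∪q⁻ p q) ⟩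
  ∣ r ∣                   ∎
  where open ℕ.≤-Reasoning

module _ {n : ℕ} where
  open DecMembership (_≟_ {n}) using () renaming (_∈?_ to _∈ˡ?_)

  elements : List (Fin n) → Subset n
  elements xs = ⟪ _∈ˡ? xs ⟫

  ∈-elements⁺ : ∀ xs {x} → x List.∈ xs → x ∈ elements xs
  ∈-elements⁺ xs = ∈⟪⟫⁺ (_∈ˡ? xs)

  ∈-elements⁻ : ∀ xs {x} → x ∈ elements xs → x List.∈ xs
  ∈-elements⁻ xs = ∈⟪⟫⁻ (_∈ˡ? xs)

-- Repetitions are allowed here: a list of vertices to be removed may name one of them twice, as can
-- happen with `a′` and `b′` in `ab`.
∣elements∣≤length : ∀ {n} (xs : List (Fin n)) → ∣ elements xs ∣ ≤ length xs
∣elements∣≤length {n} []   = subst (∣ elements {n} [] ∣ ≤_) (∣⊥∣≡0 n) (p⊆q⇒∣p∣≤∣q∣ ⊆⊥)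
  where
  ⊆⊥ : elements {n} [] ⊆ ⊥
  ⊆⊥ x∈ with () ← ∈-elements⁻ [] x∈
∣elements∣≤length (x ∷ xs) = begin
  ∣ elements (x ∷ xs) ∣       ≤⟨ ∣p∣≤∣q∣+∣r∣ split ⟩
  ∣ ⁅ x ⁆ ∣ + ∣ elements xs ∣ ≡⟨ cong (_+ ∣ elements xs ∣) (∣⁅x⁆∣≡1 x) ⟩
  suc ∣ elements xs ∣         ≤⟨ s≤s (∣elements∣≤length xs) ⟩
  suc (length xs)             ∎
  where
  open ℕ.≤-Reasoning
  split : ∀ {y} → y ∈ elements (x ∷ xs) → y ∈ ⁅ x ⁆ ⊎ y ∈ elements xs
  split y∈ with ∈-elements⁻ (x ∷ xs) y∈
  ... | here refl  = inj₁ (x∈⁅x⁆ x)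
  ... | there y∈xs = inj₂ (∈-elements⁺ xs y∈xs)

length≤∣elements∣ : ∀ {n} {xs : List (Fin n)} → Unique xs → length xs ≤ ∣ elements xs ∣
length≤∣elements∣ []                        = z≤n
length≤∣elements∣ {xs = x ∷ xs} (x∉xs ∷ !xs) = begin
  suc (length xs)             ≤⟨ s≤s (length≤∣elements∣ !xs) ⟩
  suc ∣ elements xs ∣         ≡⟨ cong (_+ ∣ elements xs ∣) (∣⁅x⁆∣≡1 x) ⟨
  ∣ ⁅ x ⁆ ∣ + ∣ elements xs ∣ ≤⟨ ∣p∣+∣q∣≤∣r∣ ⁅x⁆⊆ xs⊆ disj ⟩
  ∣ elements (x ∷ xs) ∣       ∎
  where
  open ℕ.≤-Reasoning
  ⁅x⁆⊆ : ⁅ x ⁆ ⊆ elements (x ∷ xs)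
  ⁅x⁆⊆ y∈ = ∈-elements⁺ (x ∷ xs) (here (x∈⁅y⁆⇒x≡y x y∈))
  xs⊆ : elements xs ⊆ elements (x ∷ xs)
  xs⊆ y∈ = ∈-elements⁺ (x ∷ xs) (there (∈-elements⁻ xs y∈))
  disj : ∀ {y} → y ∈ ⁅ x ⁆ → y ∉ elements xs
  disj y∈ y∈xs with refl ← x∈⁅y⁆⇒x≡y x y∈ = All.lookup x∉xs (∈-elements⁻ xs y∈xs) refl

-- Dominating sets, independent sets and the basic inequality between them.

module _ (X : Graph) where
  open Graph X using (Adj; adj?; symm; irrefl)

  closed? : (S : VertexSet X) → Decidable (N[_] X S)
  closed? S x = (x ∈? S) ⊎-dec any? (λ y → (y ∈? S) ×-dec adj? x y)

  dominating? : Decidable (Dominating X)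
  dominating? S = all? (closed? S)

  dominating-⊆ : {S T : VertexSet X} → S ⊆ T → Dominating X S → Dominating X T
  dominating-⊆ S⊆T dom x with dom x
  ... | inj₁ x∈S            = inj₁ (S⊆T x∈S)
  ... | inj₂ (y , y∈S , xy) = inj₂ (y , S⊆T y∈S , xy)

  -- Delete single vertices while domination survives. When no deletion is left, the set is minimal:
  -- a proper subset misses some `x`, so if it dominated, `S - x` would dominate too.
  minimal⊆dominating : (S : VertexSet X) → Dominating X S →
    ∃[ M ] MinimalDominating X M × M ⊆ S
  minimal⊆dominating S = go S (⊂-wellFounded S)
    where
    go : ∀ S → Acc _⊂_ S → Dominating X S → ∃[ M ] MinimalDominating X M × M ⊆ S
    go S (acc rec) dom
      with any? (λ x → (x ∈? S) ×-dec dominating? (S - x))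
    ... | yes (x , x∈S , dom′) =
      let M , min , M⊆ = go (S - x) (rec (x∈p⇒p-x⊂p x∈S)) dom′
      in M , min , ⊆-trans M⊆ (p─q⊆p S ⁅ x ⁆)
    ... | no critical = S , (dom , minimal) , ⊆-refl
      where
      minimal : ∀ T → T ⊂ S → ¬ Dominating X T
      minimal T (T⊆S , x , x∈S , x∉T) domT = critical (x , x∈S , dominating-⊆ T⊆S-x domT)
        where
        T⊆S-x : T ⊆ S - x
        T⊆S-x y∈T = x∈p∧x≢y⇒x∈p-y (T⊆S y∈T) λ { refl → x∉T y∈T }

  -- As long as a vertex lies outside the closed neighbourhood, adding it keeps the set independent.
  independent⊆dominating : (I : VertexSet X) → Independent X I →
    ∃[ M ] Independent X M × Dominating X M × I ⊆ M
  independent⊆dominating I = go I (⊃-wellFounded I)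
    where
    go : ∀ I → Acc (λ S T → T ⊂ S) I → Independent X I →
      ∃[ M ] Independent X M × Dominating X M × I ⊆ M
    go I (acc rec) ind with dominating? I
    ... | yes dom = I , ind , dom , ⊆-refl
    ... | no ¬dom =
      let M , indM , domM , ⊆M = go (I ∪ ⁅ x ⁆) (rec I⊂) ind′
      in M , indM , domM , ⊆-trans (p⊆p∪q ⁅ x ⁆) ⊆M
      where
      undominated = ¬∀⟶∃¬ _ (N[_] X I) (closed? I) ¬dom
      x   = proj₁ undominated
      x∉N = proj₂ undominated

      I⊂ : I ⊂ I ∪ ⁅ x ⁆
      I⊂ = p⊆p∪q ⁅ x ⁆ , x , x∈p∪q⁺ (inj₂ (x∈⁅x⁆ x)) , x∉N ∘ inj₁

      ind′ : Independent X (I ∪ ⁅ x ⁆)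
      ind′ {y} {z} y∈ z∈ yz with x∈p∪q⁻ I ⁅ x ⁆ y∈ | x∈p∪q⁻ I ⁅ x ⁆ z∈
      ... | inj₁ y∈I | inj₁ z∈I = ind y∈I z∈I yz
      ... | inj₁ y∈I | inj₂ z∈x with refl ← x∈⁅y⁆⇒x≡y x z∈x = x∉N (inj₂ (y , y∈I , symm yz))
      ... | inj₂ y∈x | inj₁ z∈I with refl ← x∈⁅y⁆⇒x≡y x y∈x = x∉N (inj₂ (z , z∈I , yz))
      ... | inj₂ y∈x | inj₂ z∈x
        with refl ← x∈⁅y⁆⇒x≡y x y∈x | refl ← x∈⁅y⁆⇒x≡y x z∈x = irrefl yz

  -- No vertex of an independent set has a neighbour in it, so a deleted vertex is no longer
  -- dominated.
  independent-dominating⇒minimal : (R : VertexSet X) →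
    Independent X R → Dominating X R → MinimalDominating X R
  independent-dominating⇒minimal R ind dom = dom , minimal
    where
    minimal : ∀ T → T ⊂ R → ¬ Dominating X T
    minimal T (T⊆R , x , x∈R , x∉T) domT with domT x
    ... | inj₁ x∈T            = x∉T x∈T
    ... | inj₂ (y , y∈T , xy) = ind x∈R (T⊆R y∈T) xy

  module _ (wd : WellDominated X) where

    -- Enlarge `I` to a maximal independent set and shrink `S` to a minimal dominating set. Both are
    -- minimal dominating sets, hence of equal size. All constraints on the two factors come from
    -- this inequality.
    independent≤dominating : ∀ {I S} → Independent X I → Dominating X S → ∣ I ∣ ≤ ∣ S ∣
    independent≤dominating {I} {S} ind dom =
      let R , indR , domR , I⊆R = independent⊆dominating I ind
          M , min , M⊆S         = minimal⊆dominating S dom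
      in begin
        ∣ I ∣ ≤⟨ p⊆q⇒∣p∣≤∣q∣ I⊆R ⟩
        ∣ R ∣ ≡⟨ wd R M (independent-dominating⇒minimal R indR domR) min ⟩
        ∣ M ∣ ≤⟨ p⊆q⇒∣p∣≤∣q∣ M⊆S ⟩
        ∣ S ∣ ∎
      where open ℕ.≤-Reasoning

HasNeighbours : Graph → Set
HasNeighbours G = ∀ x → ∃[ y ] Graph.Adj G x y

Complete : Graph → Set
Complete G = ∀ {x y} → x ≢ y → Graph.Adj G x y

another : ∀ {n} → 2 ≤ n → (x : Fin n) → ∃[ y ] x ≢ y
another (s≤s (s≤s _)) zero    = suc zero , λ ()
another (s≤s (s≤s _)) (suc x) = zero , λ ()

-- The neighbour is the first step of a walk to some other vertex.
connected⇒hasNeighbours : ∀ {G} → Nontrivial G → Connected G → HasNeighbours G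
connected⇒hasNeighbours nt con x with another nt x
... | y , x≢y with con x y
...   | ε      = ⊥-elim (x≢y refl)
...   | xz ◅ _ = _ , xz

-- Vertex sets of a direct product, described by predicates on the two coordinates.

module ProductSets (G H : Graph) where
  private
    module G = Graph G
    module H = Graph H
    X = G ×ᴳ H

  pairs : {P : Vertex G → Vertex H → Set} → (∀ g h → Dec (P g h)) → VertexSet X
  pairs P? = ⟪ (λ i → P? (quotient (order H) i) (remainder {order G} (order H) i)) ⟫

  adjacent-combine : ∀ {i g h} → G.Adj (quotient (order H) i) g →
    H.Adj (remainder {order G} (order H) i) h → Graph.Adj X i (combine g h)
  adjacent-combine {i} {g} {h} a b =
    subst (λ (g , h) → G.Adj (quotient (order H) i) g × H.Adj (remainder {order G} (order H) i) h)
      (sym (remQuot-combine g h)) (a , b)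

  module _ {P : Vertex G → Vertex H → Set} (P? : ∀ g h → Dec (P g h)) where

    ∈-pairs⁺ : ∀ {i} → P (quotient (order H) i) (remainder {order G} (order H) i) → i ∈ pairs P?
    ∈-pairs⁺ = ∈⟪⟫⁺ (λ i → P? (quotient (order H) i) (remainder {order G} (order H) i))

    ∈-pairs⁻ : ∀ {i} → i ∈ pairs P? → P (quotient (order H) i) (remainder {order G} (order H) i)
    ∈-pairs⁻ = ∈⟪⟫⁻ (λ i → P? (quotient (order H) i) (remainder {order G} (order H) i))

    combine∈pairs : ∀ {g h} → P g h → combine g h ∈ pairs P?
    combine∈pairs {g} {h} p = ∈-pairs⁺ (subst (uncurry P) (sym (remQuot-combine g h)) p)

    pairs-dominating :
      (∀ g h → P g h ⊎ ∃₂ λ g′ h′ → P g′ h′ × G.Adj g g′ × H.Adj h h′) →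
      Dominating X (pairs P?)
    pairs-dominating dom i with dom (quotient (order H) i) (remainder {order G} (order H) i)
    ... | inj₁ p = inj₁ (∈-pairs⁺ p)
    ... | inj₂ (g , h , p , gg′ , hh′) =
      inj₂ (combine g h , combine∈pairs p , adjacent-combine gg′ hh′)

    pairs-independent :
      (∀ {g h g′ h′} → P g h → P g′ h′ → G.Adj g g′ → ¬ H.Adj h h′) →
      Independent X (pairs P?)
    pairs-independent ind i∈ j∈ (gg′ , hh′) = ind (∈-pairs⁻ i∈) (∈-pairs⁻ j∈) gg′ hh′

-- A factor without isolatable vertices is complete.

module _ {G H : Graph} (h₀ : Vertex H) (hasH : HasNeighbours H)
         (wd : WellDominated (G ×ᴳ H)) (noIso : NoIsolatableVertices G) where
  open ProductSets G H
  private
    module G = Graph G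
    module H = Graph H
    X = G ×ᴳ H

    Near : Vertex G → Vertex G → Set
    Near u g = g ≡ u ⊎ G.Adj g u

    near? : ∀ u g → Dec (Near u g)
    near? u g = (g ≟ u) ⊎-dec G.adj? g u

    Near⇒N : ∀ {u g} → Near u g → N[_] G ⁅ u ⁆ g
    Near⇒N {u} (inj₁ refl) = inj₁ (x∈⁅x⁆ u)
    Near⇒N {u} (inj₂ gu)   = inj₂ (u , x∈⁅x⁆ u , gu)

    N⇒Near : ∀ {u g} → N[_] G ⁅ u ⁆ g → Near u g
    N⇒Near {u} (inj₁ g∈) = inj₁ (x∈⁅y⁆⇒x≡y u g∈)
    N⇒Near {u} (inj₂ (v , v∈ , gv)) with refl ← x∈⁅y⁆⇒x≡y u v∈ = inj₂ gv

    -- Otherwise `g` would be isolated in G - N[u], and the independent set {u} would make it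
    -- isolatable.
    farNeighbour : ∀ u g → ¬ Near u g → ∃[ g′ ] ¬ Near u g′ × G.Adj g g′
    farNeighbour u g far with any? (λ g′ → ¬? (near? u g′) ×-dec G.adj? g g′)
    ... | yes found = found
    ... | no ¬found = ⊥-elim (noIso g (⁅ u ⁆ , ind , far ∘ N⇒Near ,
      λ y y∉N gy → ¬found (y , y∉N ∘ Near⇒N , gy)))
      where
      ind : Independent G ⁅ u ⁆
      ind x∈ y∈ xy with refl ← x∈⁅y⁆⇒x≡y u x∈ | refl ← x∈⁅y⁆⇒x≡y u y∈ = G.irrefl xy

    -- Extending the empty set gives a maximal independent set `J` of H, which is therefore
    -- dominating.
    maximal = independent⊆dominating H ⊥ λ x∈⊥ → ⊥-elim (∉⊥ x∈⊥)
    J    = proj₁ maximal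
    indJ = proj₁ (proj₂ maximal)
    domJ = proj₁ (proj₂ (proj₂ maximal))

    j₀ : ∃[ j ] j ∈ J
    j₀ with domJ h₀
    ... | inj₁ h∈J           = h₀ , h∈J
    ... | inj₂ (j , j∈J , _) = j , j∈J

    -- The predicate of the set S(u) compared in `adjacent-trans`; `Two` belongs to the first
    -- independent set there and `fibres?` to G × `J`.
    One : Vertex G → Vertex G → Vertex H → Set
    One u g h = g ≡ u ⊎ ¬ Near u g × h ∈ J

    one? : ∀ u g h → Dec (One u g h)
    one? u g h = (g ≟ u) ⊎-dec (¬? (near? u g) ×-dec (h ∈? J))

    Two : Vertex G → Vertex G → Vertex G → Vertex H → Set
    Two u v g h = (g ≡ u ⊎ g ≡ v) ⊎ (¬ Near u g × ¬ Near v g) × h ∈ J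

    two? : ∀ u v g h → Dec (Two u v g h)
    two? u v g h = ((g ≟ u) ⊎-dec (g ≟ v)) ⊎-dec
      ((¬? (near? u g) ×-dec ¬? (near? v g)) ×-dec (h ∈? J))

    fibres? : ∀ (g : Vertex G) h → Dec (h ∈ J)
    fibres? g h = h ∈? J

    -- Over N(u) the full fibre {u} × H dominates, since H has no isolated vertex. Outside N[u], a
    -- neighbour of `h` in `J` is paired with a neighbour of `g` that also avoids N[u].
    one-dominating : ∀ u → Dominating X (pairs (one? u))
    one-dominating u = pairs-dominating (one? u) dom
      where
      dom : ∀ g h → One u g h ⊎ ∃₂ λ g′ h′ → One u g′ h′ × G.Adj g g′ × H.Adj h h′
      dom g h with near? u g
      ... | yes (inj₁ g≡u) = inj₁ (inj₁ g≡u)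
      ... | yes (inj₂ gu)  = let h′ , hh′ = hasH h in inj₂ (u , h′ , inj₁ refl , gu , hh′)
      ... | no far with domJ h
      ...   | inj₁ h∈J = inj₁ (inj₂ (far , h∈J))
      ...   | inj₂ (h′ , h′∈J , hh′) =
        let g′ , far′ , gg′ = farNeighbour u g far
        in inj₂ (g′ , h′ , inj₂ (far′ , h′∈J) , gg′ , hh′)

    two-independent : ∀ {u v} → ¬ G.Adj u v → Independent X (pairs (two? u v))
    two-independent {u} {v} u≁v = pairs-independent (two? u v) ind
      where
      ind : ∀ {g h g′ h′} → Two u v g h → Two u v g′ h′ → G.Adj g g′ → ¬ H.Adj h h′
      ind (inj₁ (inj₁ refl)) (inj₁ (inj₁ refl)) gg′ _ = G.irrefl gg′
      ind (inj₁ (inj₁ refl)) (inj₁ (inj₂ refl)) gg′ _ = u≁v gg′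
      ind (inj₁ (inj₂ refl)) (inj₁ (inj₁ refl)) gg′ _ = u≁v (G.symm gg′)
      ind (inj₁ (inj₂ refl)) (inj₁ (inj₂ refl)) gg′ _ = G.irrefl gg′
      ind (inj₁ (inj₁ refl)) (inj₂ ((far , _) , _)) gg′ _ = far (inj₂ (G.symm gg′))
      ind (inj₁ (inj₂ refl)) (inj₂ ((_ , far) , _)) gg′ _ = far (inj₂ (G.symm gg′))
      ind (inj₂ ((far , _) , _)) (inj₁ (inj₁ refl)) gg′ _ = far (inj₂ gg′)
      ind (inj₂ ((_ , far) , _)) (inj₁ (inj₂ refl)) gg′ _ = far (inj₂ gg′)
      ind (inj₂ (_ , h∈J)) (inj₂ (_ , h′∈J)) _ hh′ = indJ h∈J h′∈J hh′

    fibres-independent : Independent X (pairs fibres?)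
    fibres-independent = pairs-independent fibres? λ h∈J h′∈J _ → indJ h∈J h′∈J

  -- S(u) = {u} × H ∪ (G ∖ N[u]) × J dominates, as no vertex is isolated in
  -- G − N[u].  For non-adjacent u and v, the sets {u , v} × H ∪ (G ∖ N[{u , v}]) × J
  -- and G × J are independent; together they contain each vertex at least as
  -- often as S(u) and S(v), and those of {w} × J once more when w ∈ N(u) ∩ N(v).
  adjacent-trans : ∀ {u w v} → u ≢ v → G.Adj u w → G.Adj w v → G.Adj u v
  adjacent-trans {u} {w} {v} u≢v uw wv = decidable-stable (G.adj? u v) λ u≁v →
    ℕ.<⇒≱ counts (ℕ.+-mono-≤
      (independent≤dominating X wd (two-independent u≁v) (one-dominating u))
      (independent≤dominating X wd fibres-independent (one-dominating v)))
    where
    A = pairs (one? u)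
    B = pairs (one? v)
    C = pairs (two? u v)
    D = pairs fibres?

    ∪⊆ : A ∪ B ⊆ C ∪ D
    ∪⊆ x∈ with x∈p∪q⁻ A B x∈
    ... | inj₁ x∈A with ∈-pairs⁻ (one? u) x∈A
    ...   | inj₁ g≡u       = x∈p∪q⁺ (inj₁ (∈-pairs⁺ (two? u v) (inj₁ (inj₁ g≡u))))
    ...   | inj₂ (_ , h∈J) = x∈p∪q⁺ (inj₂ (∈-pairs⁺ fibres? h∈J))
    ∪⊆ x∈ | inj₂ x∈B with ∈-pairs⁻ (one? v) x∈B
    ...   | inj₁ g≡v       = x∈p∪q⁺ (inj₁ (∈-pairs⁺ (two? u v) (inj₁ (inj₂ g≡v))))
    ...   | inj₂ (_ , h∈J) = x∈p∪q⁺ (inj₂ (∈-pairs⁺ fibres? h∈J))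

    ∩⊆ : A ∩ B ⊆ C ∩ D
    ∩⊆ x∈ with x∈p∩q⁻ A B x∈
    ... | x∈A , x∈B with ∈-pairs⁻ (one? u) x∈A | ∈-pairs⁻ (one? v) x∈B
    ...   | inj₁ g≡u         | inj₁ g≡v       = ⊥-elim (u≢v (trans (sym g≡u) g≡v))
    ...   | inj₁ g≡u         | inj₂ (_ , h∈J) = x∈p∩q⁺
      (∈-pairs⁺ (two? u v) (inj₁ (inj₁ g≡u)) , ∈-pairs⁺ fibres? h∈J)
    ...   | inj₂ (_ , h∈J)   | inj₁ g≡v       = x∈p∩q⁺
      (∈-pairs⁺ (two? u v) (inj₁ (inj₂ g≡v)) , ∈-pairs⁺ fibres? h∈J)
    ...   | inj₂ (far , h∈J) | inj₂ (far′ , _) = x∈p∩q⁺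
      (∈-pairs⁺ (two? u v) (inj₂ ((far , far′) , h∈J)) , ∈-pairs⁺ fibres? h∈J)

    w,j = combine w (proj₁ j₀)

    w,j∉ : ∀ {x} → G.Adj w x → w,j ∉ pairs (one? x)
    w,j∉ {x} wx ∈S with subst (uncurry (One x)) (remQuot-combine w (proj₁ j₀)) (∈-pairs⁻ (one? x) ∈S)
    ... | inj₁ refl      = G.irrefl wx
    ... | inj₂ (far , _) = far (inj₂ wx)

    ∪⊂ : A ∪ B ⊂ C ∪ D
    ∪⊂ = ∪⊆ , w,j , x∈p∪q⁺ (inj₂ (combine∈pairs fibres? (proj₂ j₀))) ,
      [ w,j∉ (G.symm uw) , w,j∉ wv ]′ ∘ x∈p∪q⁻ A B

    counts : ∣ A ∣ + ∣ B ∣ < ∣ C ∣ + ∣ D ∣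
    counts = begin-strict
      ∣ A ∣ + ∣ B ∣         ≡⟨ ∣p∣+∣q∣≡∣p∪q∣+∣p∩q∣ A B ⟩
      ∣ A ∪ B ∣ + ∣ A ∩ B ∣ <⟨ ℕ.+-mono-<-≤ (p⊂q⇒∣p∣<∣q∣ ∪⊂) (p⊆q⇒∣p∣≤∣q∣ ∩⊆) ⟩
      ∣ C ∪ D ∣ + ∣ C ∩ D ∣ ≡⟨ ∣p∣+∣q∣≡∣p∪q∣+∣p∩q∣ C D ⟨
      ∣ C ∣ + ∣ D ∣         ∎
      where open ℕ.≤-Reasoning

  -- Transitivity contracts a walk, starting from its far end, to a single edge or to nothing.
  noIsolatable⇒complete : Connected G → Complete G
  noIsolatable⇒complete con x≢y = [ ⊥-elim ∘ x≢y , id ]′ (go (con _ _))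
    where
    go : ∀ {x y} → Star G.Adj x y → x ≡ y ⊎ G.Adj x y
    go ε = inj₁ refl
    go {x} {y} (xz ◅ zy) with go zy
    ... | inj₁ refl = inj₂ xz
    ... | inj₂ z~y with x ≟ y
    ...   | yes x≡y = inj₁ x≡y
    ...   | no  x≢y = inj₂ (adjacent-trans x≢y xz z~y)

-- Local exchanges in a fibre over a vertex of a complete factor.

length-cartesianProductWith : ∀ {A B C : Set} (f : A → B → C) xs ys →
  length (cartesianProductWith f xs ys) ≡ length xs * length ys
length-cartesianProductWith f []       ys = refl
length-cartesianProductWith f (x ∷ xs) ys = trans (length-++ (map (f x) ys))
  (cong₂ _+_ (length-map (f x) ys) (length-cartesianProductWith f xs ys))

module Exchange (G H : Graph) (complete : Complete G) (hasH : HasNeighbours H)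
                (wd : WellDominated (G ×ᴳ H)) (c₁ : Vertex G) where
  open ProductSets G H
  private
    module G = Graph G
    module H = Graph H
    X = G ×ᴳ H
    open DecMembership (_≟_ {G.order}) using () renaming (_∈?_ to _∈ᴳ?_)
    open DecMembership (_≟_ {H.order}) using () renaming (_∈?_ to _∈ᴴ?_)

    fibre? : ∀ g (h : Vertex H) → Dec (g ≡ c₁)
    fibre? g h = g ≟ c₁

    fibre = pairs fibre?

    fibre-independent : Independent X fibre
    fibre-independent = pairs-independent fibre? λ { refl refl gg′ _ → G.irrefl gg′ }

    -- Completeness joins every other `g` to `c₁`, and `h` has a neighbour in H. Being independent
    -- as well, the fibre is the yardstick for both exchanges.
    fibre-dominating : Dominating X fibre
    fibre-dominating = pairs-dominating fibre? dom
      where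
      dom : ∀ g h → g ≡ c₁ ⊎ ∃₂ λ g′ h′ → g′ ≡ c₁ × G.Adj g g′ × H.Adj h h′
      dom g h with g ≟ c₁
      ... | yes g≡c₁ = inj₁ g≡c₁
      ... | no  g≢c₁ = let h′ , hh′ = hasH h in inj₂ (c₁ , h′ , refl , complete g≢c₁ , hh′)

    Rest : List (Vertex H) → Vertex G → Vertex H → Set
    Rest xs g h = g ≡ c₁ × ¬ (h List.∈ xs)

    rest? : ∀ xs g h → Dec (Rest xs g h)
    rest? xs g h = (g ≟ c₁) ×-dec ¬? (h ∈ᴴ? xs)

    removed : List (Vertex H) → VertexSet X
    removed xs = elements (map (combine c₁) xs)

    removed⊆fibre : ∀ xs → removed xs ⊆ fibre
    removed⊆fibre xs i∈ with ∈-map⁻ (combine c₁) (∈-elements⁻ (map (combine c₁) xs) i∈)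
    ... | x , _ , refl = combine∈pairs fibre? refl

    rest∩removed : ∀ xs {i} → i ∈ pairs (rest? xs) → i ∉ removed xs
    rest∩removed xs {i} i∈ i∈′
      with ∈-map⁻ (combine c₁) (∈-elements⁻ (map (combine c₁) xs) i∈′)
    ... | x , x∈xs , refl = proj₂ (∈-pairs⁻ (rest? xs) i∈)
      (subst (List._∈ xs) (sym (cong proj₂ (remQuot-combine c₁ x))) x∈xs)

    fibre⊆ : ∀ xs {i} → i ∈ fibre → i ∈ pairs (rest? xs) ⊎ i ∈ removed xs
    fibre⊆ xs {i} i∈ with remainder {G.order} H.order i ∈ᴴ? xs
    ... | no  h∉xs = inj₁ (∈-pairs⁺ (rest? xs) (∈-pairs⁻ fibre? i∈ , h∉xs))
    ... | yes h∈xs = inj₂ (∈-elements⁺ (map (combine c₁) xs)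
      (subst (List._∈ map (combine c₁) xs)
        (trans (cong (λ g → combine g (remainder {G.order} H.order i)) (sym (∈-pairs⁻ fibre? i∈)))
               (combine-remQuot {G.order} H.order i))
        (∈-map⁺ (combine c₁) h∈xs)))

  -- Replace the part c₁ × xs of the fibre over c₁ by cs × T: the result is
  -- still independent, hence not larger than the fibre.
  independent-exchange : ∀ cs T xs → Unique cs → ¬ (c₁ List.∈ cs) → Unique T →
    (∀ {s t} → s List.∈ T → t List.∈ T → ¬ H.Adj s t) →
    (∀ {t y} → t List.∈ T → H.Adj t y → y List.∈ xs) →
    length cs * length T ≤ length xs
  independent-exchange cs T xs !cs c₁∉cs !T indT N[T]⊆xs =
    subst (_≤ length xs) (length-cartesianProductWith combine cs T)
      (ℕ.+-cancelˡ-≤ ∣ R ∣ _ _ (begin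
        ∣ R ∣ + length added                ≤⟨ ℕ.+-monoʳ-≤ ∣ R ∣ (length≤∣elements∣ !added) ⟩
        ∣ R ∣ + ∣ elements added ∣          ≤⟨ ∣p∣+∣q∣≤∣r∣ R⊆I added⊆I disj ⟩
        ∣ I ∣                               ≤⟨ independent≤dominating X wd I-independent fibre-dominating ⟩
        ∣ fibre ∣                           ≤⟨ ∣p∣≤∣q∣+∣r∣ (fibre⊆ xs) ⟩
        ∣ R ∣ + ∣ removed xs ∣              ≤⟨ ℕ.+-monoʳ-≤ ∣ R ∣ (∣elements∣≤length (map (combine c₁) xs)) ⟩
        ∣ R ∣ + length (map (combine c₁) xs) ≡⟨ cong (∣ R ∣ +_) (length-map (combine c₁) xs) ⟩
        ∣ R ∣ + length xs                   ∎))
    where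
    open ℕ.≤-Reasoning
    R     = pairs (rest? xs)
    added = cartesianProductWith combine cs T

    !added : Unique added
    !added = cartesianProductWith⁺ combine (combine-injective _ _ _ _) !cs !T

    new? : ∀ g h → Dec (Rest xs g h ⊎ g List.∈ cs × h List.∈ T)
    new? g h = rest? xs g h ⊎-dec ((g ∈ᴳ? cs) ×-dec (h ∈ᴴ? T))

    I = pairs new?

    I-independent : Independent X I
    I-independent = pairs-independent new? λ where
      (inj₁ (refl , _))    (inj₁ (refl , _))    gg′ _   → G.irrefl gg′
      (inj₁ (_ , h∉xs))    (inj₂ (_ , h′∈T))    _   hh′ → h∉xs (N[T]⊆xs h′∈T (H.symm hh′))
      (inj₂ (_ , h∈T))     (inj₁ (_ , h′∉xs))   _   hh′ → h′∉xs (N[T]⊆xs h∈T hh′)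
      (inj₂ (_ , h∈T))     (inj₂ (_ , h′∈T))    _   hh′ → indT h∈T h′∈T hh′

    R⊆I : R ⊆ I
    R⊆I i∈ = ∈-pairs⁺ new? (inj₁ (∈-pairs⁻ (rest? xs) i∈))

    added⊆I : elements added ⊆ I
    added⊆I i∈ with ∈-cartesianProductWith⁻ combine cs T (∈-elements⁻ added i∈)
    ... | c , t , c∈cs , t∈T , refl = combine∈pairs new? (inj₂ (c∈cs , t∈T))

    disj : ∀ {i} → i ∈ R → i ∉ elements added
    disj i∈R i∈ with ∈-cartesianProductWith⁻ combine cs T (∈-elements⁻ added i∈)
    ... | c , t , c∈cs , t∈T , refl = c₁∉cs
      (subst (List._∈ cs)
        (trans (sym (cong proj₁ (remQuot-combine c t))) (proj₁ (∈-pairs⁻ (rest? xs) i∈R))) c∈cs)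

  -- Replacing (c₁ , a) and (c₁ , b) by the single vertex (c₂ , p) makes the
  -- fibre over c₁ too small to be dominating; (c , k) is a vertex it misses.
  dominating-exchange : ∀ {c₂ p a b} → c₁ ≢ c₂ → a ≢ b → H.Adj p a → H.Adj p b →
    ∃[ k ] (∀ {y} → H.Adj k y → y ≡ a ⊎ y ≡ b) × (k ≡ p → ∃[ c ] c ≢ c₁ × c ≢ c₂)
  dominating-exchange {c₂} {p} {a} {b} c₁≢c₂ a≢b pa pb =
    -- If k = p, then c = c₂ would put the missed vertex (c , k) into `D`; so c is a third vertex of
    -- G.
    k , only , λ k≡p → c , c≢c₁ , λ c≡c₂ → missed (inj₁ (∈-pairs⁺ new? (inj₂ (c≡c₂ , k≡p))))
    where
    xs = a ∷ b ∷ []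
    R  = pairs (rest? xs)

    new? : ∀ g h → Dec (Rest xs g h ⊎ g ≡ c₂ × h ≡ p)
    new? g h = rest? xs g h ⊎-dec ((g ≟ c₂) ×-dec (h ≟ p))

    D = pairs new?

    D⊆ : ∀ {i} → i ∈ D → i ∈ R ⊎ i ∈ ⁅ combine c₂ p ⁆
    D⊆ {i} i∈ with ∈-pairs⁻ new? i∈
    ... | inj₁ r = inj₁ (∈-pairs⁺ (rest? xs) r)
    ... | inj₂ (g≡c₂ , h≡p) = inj₂ (subst (_∈ ⁅ combine c₂ p ⁆)
      (trans (sym (cong₂ combine g≡c₂ h≡p)) (combine-remQuot {G.order} H.order i)) (x∈⁅x⁆ _))

    !removed : Unique (map (combine c₁) xs)
    !removed = ((λ eq → a≢b (proj₂ (combine-injective c₁ a c₁ b eq))) ∷ []) ∷ ([] ∷ [])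

    ∣D∣<∣fibre∣ : ∣ D ∣ < ∣ fibre ∣
    ∣D∣<∣fibre∣ = begin
      suc ∣ D ∣                           ≤⟨ s≤s (∣p∣≤∣q∣+∣r∣ D⊆) ⟩
      suc (∣ R ∣ + ∣ ⁅ combine c₂ p ⁆ ∣)  ≡⟨ cong (λ m → suc (∣ R ∣ + m)) (∣⁅x⁆∣≡1 (combine c₂ p)) ⟩
      suc (∣ R ∣ + 1)                     ≡⟨ ℕ.+-suc ∣ R ∣ 1 ⟨
      ∣ R ∣ + 2                           ≤⟨ ℕ.+-monoʳ-≤ ∣ R ∣ (length≤∣elements∣ !removed) ⟩
      ∣ R ∣ + ∣ removed xs ∣              ≤⟨ ∣p∣+∣q∣≤∣r∣ R⊆fibre (removed⊆fibre xs) (rest∩removed xs) ⟩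
      ∣ fibre ∣                           ∎
      where
      open ℕ.≤-Reasoning
      R⊆fibre : R ⊆ fibre
      R⊆fibre i∈ = ∈-pairs⁺ fibre? (proj₁ (∈-pairs⁻ (rest? xs) i∈))

    undominated = ¬∀⟶∃¬ _ (N[_] X D) (closed? X D) λ dom →
      ℕ.<⇒≱ ∣D∣<∣fibre∣ (independent≤dominating X wd fibre-independent dom)

    i      = proj₁ undominated
    missed = proj₂ undominated
    c      = quotient H.order i
    k      = remainder {G.order} H.order i

    kp : k List.∈ xs → H.Adj k p
    kp (here k≡a)         = subst (λ z → H.Adj z p) (sym k≡a) (H.symm pa)
    kp (there (here k≡b)) = subst (λ z → H.Adj z p) (sym k≡b) (H.symm pb)

    -- A vertex of the fibre over `c₁` is either kept in `D`, or it is (c₁ , a) or (c₁ , b), both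
    -- adjacent to (c₂ , p).
    c≢c₁ : c ≢ c₁
    c≢c₁ c≡c₁ = case k ∈ᴴ? xs of λ where
      (no k∉xs)  → missed (inj₁ (∈-pairs⁺ new? (inj₁ (c≡c₁ , k∉xs))))
      (yes k∈xs) → missed (inj₂ (combine c₂ p , combine∈pairs new? (inj₂ (refl , refl)) ,
        adjacent-combine (complete λ c≡c₂ → c₁≢c₂ (trans (sym c≡c₁) c≡c₂)) (kp k∈xs)))

    -- A neighbour `y` of `k` other than `a` and `b` leaves (c₁ , y) in `D`, and this vertex is
    -- adjacent to (c , k) because c ≠ c₁.
    only : ∀ {y} → H.Adj k y → y ≡ a ⊎ y ≡ b
    only {y} ky = case y ∈ᴴ? xs of λ where
      (yes (here y≡a))         → inj₁ y≡a
      (yes (there (here y≡b))) → inj₂ y≡b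
      (no y∉xs) → ⊥-elim (missed (inj₂ (combine c₁ y ,
        combine∈pairs new? (inj₁ (refl , y∉xs)) , adjacent-combine (complete c≢c₁) ky)))

-- Isomorphisms from explicit bijections.

lookup-injective : ∀ {A : Set} {xs : List A} → Unique xs →
  ∀ {i j} → lookup xs i ≡ lookup xs j → i ≡ j
lookup-injective (_ ∷ _)    {zero}  {zero}  _  = refl
lookup-injective (x∉ ∷ _)   {zero}  {suc j} eq = ⊥-elim (All.lookup x∉ (∈-lookup j) eq)
lookup-injective (x∉ ∷ _)   {suc i} {zero}  eq = ⊥-elim (All.lookup x∉ (∈-lookup i) (sym eq))
lookup-injective (_ ∷ !xs)  {suc i} {suc j} eq = cong suc (lookup-injective !xs eq)

module _ {G G′ : Graph} (f : Vertex G′ → Vertex G)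
  (f-injective : ∀ {x y} → f x ≡ f y → x ≡ y) (f-surjective : ∀ v → ∃[ x ] f x ≡ v)
  (preserves : ∀ x y → Graph.Adj G′ x y → Graph.Adj G (f x) (f y))
  (reflects  : ∀ x y → Graph.Adj G (f x) (f y) → Graph.Adj G′ x y) where

  -- The given map runs from the model `G′` into `G`, so that it can be defined on the concrete
  -- vertices of the model; its inverse is read off from surjectivity.
  bijection⇒≅ : G ≅ G′
  bijection⇒≅ = record
    { bijection = mk↔ₛ′ (proj₁ ∘ f-surjective) f
        (λ x → f-injective (proj₂ (f-surjective (f x)))) (proj₂ ∘ f-surjective)
    ; adjacency = λ x y → mk⇔
        (λ xy → reflects _ _ (subst₂ (Graph.Adj G)
          (sym (proj₂ (f-surjective x))) (sym (proj₂ (f-surjective y))) xy))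
        (λ xy → subst₂ (Graph.Adj G) (proj₂ (f-surjective x)) (proj₂ (f-surjective y))
          (preserves _ _ xy))
    }

complete⇒≅K : ∀ {G n} → Complete G → n ≡ order G → G ≅ K n
complete⇒≅K {G} complete refl = bijection⇒≅ id id (λ v → v , refl)
  (λ _ _ → complete) (λ { x y xy refl → Graph.irrefl G xy })

-- Leaves and supports, and the recognition of K₃, the 4-cycle and coronas.

module Leaves (H : Graph) where
  open Graph H using (Adj; adj?; irrefl)

  adjacent⇒≢ : ∀ {x y} → Adj x y → x ≢ y
  adjacent⇒≢ xy refl = irrefl xy

  Only : Vertex H → Vertex H → Vertex H → Set
  Only k a b = ∀ {y} → Adj k y → y ≡ a ⊎ y ≡ b

  excluded : ∀ {k a b x} → Only k a b → x ≢ a → x ≢ b → ¬ Adj k x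
  excluded Nk x≢a x≢b kx = [ x≢a , x≢b ]′ (Nk kx)

  Leaf : Vertex H → Vertex H → Set
  Leaf l s = Adj l s × (∀ y → Adj l y → y ≡ s)

  leaf? : ∀ l s → Dec (Leaf l s)
  leaf? l s = adj? l s ×-dec all? λ y → adj? l y →-dec (y ≟ s)

  -- The supports. In a connected graph a vertex is both a support and a leaf only if the graph is a
  -- single edge.
  HasLeaf : Vertex H → Set
  HasLeaf s = ∃[ l ] Leaf l s

  IsLeaf : Vertex H → Set
  IsLeaf l = ∃[ s ] Leaf l s

module _ (H : Graph) (con : Connected H) (hasH : HasNeighbours H) where
  private module H = Graph H
  open H using (Adj; adj?; symm; irrefl)
  open Leaves H

  -- Used to obtain surjectivity onto H from an image closed under adjacency, and to spread the
  -- division into supports and leaves from one vertex to all.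
  closed⇒all : {P : Vertex H → Set} → (∀ {x y} → P x → Adj x y → P y) →
    ∀ {x} → P x → ∀ y → P y
  closed⇒all {P} closed {x} px y = go px (con x y)
    where
    go : ∀ {x} → P x → Star Adj x y → P y
    go px ε         = px
    go px (xz ◅ zy) = go (closed px xz) zy

  module Leafless (noLeaf : ∀ l s → ¬ Leaf l s) where

    second : ∀ {x y} → Adj x y → ∃[ z ] z ≢ y × Adj x z
    second {x} {y} xy with any? (λ z → ¬? (z ≟ y) ×-dec adj? x z)
    ... | yes found = found
    ... | no ¬found = ⊥-elim (noLeaf x y (xy , λ z xz →
      decidable-stable (z ≟ y) λ z≢y → ¬found (z , z≢y , xz)))

    two : ∀ x → ∃₂ λ a b → a ≢ b × Adj x a × Adj x b
    two x = let a , xa = hasH x ; b , b≢a , xb = second xa in a , b , ≢-sym b≢a , xa , xb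

    -- Without leaves `k` has two distinct neighbours, which leaves only `a` and `b` for them.
    both : ∀ {k a b} → Only k a b → Adj k a × Adj k b
    both {k} only with two k
    ... | x , y , x≢y , kx , ky with only kx | only ky
    ...   | inj₁ refl | inj₁ refl = ⊥-elim (x≢y refl)
    ...   | inj₁ refl | inj₂ refl = kx , ky
    ...   | inj₂ refl | inj₁ refl = ky , kx
    ...   | inj₂ refl | inj₂ refl = ⊥-elim (x≢y refl)

    module _ (only : ∀ {p a b} → a ≢ b → Adj p a → Adj p b → ∃[ k ] Only k a b) where

      -- If p has a third neighbour e, take N(k) = {a , b}, N(l) = {a , e} and then
      -- N(q) = {k , l}.  Now q ∈ N(k), but q ≠ a since p ∈ N(a), and q ≠ b since
      -- l is not adjacent to b.
      degree-two : ∀ {p a b} → a ≢ b → Adj p a → Adj p b → Only p a b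
      degree-two {p} {a} {b} a≢b pa pb {e} pe with e ≟ a | e ≟ b
      ... | yes e≡a | _       = inj₁ e≡a
      ... | no _    | yes e≡b = inj₂ e≡b
      ... | no e≢a  | no e≢b
        with k , Nk ← only a≢b pa pb | l , Nl ← only (≢-sym e≢a) pa pe
        with ka , kb ← both Nk | la , le ← both Nl
        -- k ≠ l, because `b` is adjacent to `k` but is excluded from N(l).
        with q , Nq ← only {a} {k} {l} (λ { refl → excluded Nl (≢-sym a≢b) (≢-sym e≢b) kb })
                      (symm ka) (symm la)
        with qk , ql ← both Nq
        with Nk (symm qk)
      ... | inj₂ refl = ⊥-elim (excluded Nl (≢-sym a≢b) (≢-sym e≢b) (symm ql))
      -- Now q = a, so its neighbour `p` is `k` or `l`. But `p` is adjacent to `e`, which `k` is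
      -- not, and to `b`, which `l` is not.
      ... | inj₁ refl with Nq (symm pa)
      ...   | inj₁ refl = ⊥-elim (excluded Nk e≢a e≢b pe)
      ...   | inj₂ refl = ⊥-elim (excluded Nl (≢-sym a≢b) (≢-sym e≢b) pb)

  module _ {p a b} (pa : Adj p a) (pb : Adj p b) (ab : Adj a b)
    (Np : Only p a b) (Na : Only a p b) (Nb : Only b p a) where

    triangle⇒≅K₃ : H ≅ K 3
    triangle⇒≅K₃ = bijection⇒≅ f
      -- Distinct indices have adjacent images, which irreflexivity keeps distinct.
      (λ {x} {y} eq → decidable-stable (x ≟ y) λ x≢y → adjacent⇒≢ (preserves x y x≢y) eq)
      (closed⇒all closed (0F , refl)) preserves (λ { x y xy refl → irrefl xy })
      where
      f : Fin 3 → Vertex H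
      f 0F = p
      f 1F = a
      f 2F = b

      closed : ∀ {x y} → ∃[ i ] f i ≡ x → Adj x y → ∃[ i ] f i ≡ y
      closed (0F , refl) xy = [ (λ e → 1F , sym e) , (λ e → 2F , sym e) ]′ (Np xy)
      closed (1F , refl) xy = [ (λ e → 0F , sym e) , (λ e → 2F , sym e) ]′ (Na xy)
      closed (2F , refl) xy = [ (λ e → 0F , sym e) , (λ e → 1F , sym e) ]′ (Nb xy)

      preserves : ∀ x y → x ≢ y → Adj (f x) (f y)
      preserves 0F 0F x≢y = ⊥-elim (x≢y refl)
      preserves 0F 1F _   = pa
      preserves 0F 2F _   = pb
      preserves 1F 0F _   = symm pa
      preserves 1F 1F x≢y = ⊥-elim (x≢y refl)
      preserves 1F 2F _   = ab
      preserves 2F 0F _   = symm pb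
      preserves 2F 1F _   = symm ab
      preserves 2F 2F x≢y = ⊥-elim (x≢y refl)

  module _ {p a k b} (p≢k : p ≢ k) (a≢b : a ≢ b)
    (pa : Adj p a) (pb : Adj p b) (ka : Adj k a) (kb : Adj k b)
    (Np : Only p a b) (Nk : Only k a b) (Na : Only a p k) (Nb : Only b p k) where

    square⇒≅C₄ : H ≅ C₄
    square⇒≅C₄ = bijection⇒≅ f (lookup-injective distinct)
      (closed⇒all closed (0F , refl)) preserves reflects
      where
      f : Fin 4 → Vertex H
      f = lookup (p ∷ a ∷ k ∷ b ∷ [])

      distinct : Unique (p ∷ a ∷ k ∷ b ∷ [])
      distinct = (adjacent⇒≢ pa ∷ p≢k ∷ adjacent⇒≢ pb ∷ [])
        ∷ (≢-sym (adjacent⇒≢ ka) ∷ a≢b ∷ [])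
        ∷ (adjacent⇒≢ kb ∷ []) ∷ [] ∷ []

      closed : ∀ {x y} → ∃[ i ] f i ≡ x → Adj x y → ∃[ i ] f i ≡ y
      closed (0F , refl) xy = [ (λ e → 1F , sym e) , (λ e → 3F , sym e) ]′ (Np xy)
      closed (1F , refl) xy = [ (λ e → 0F , sym e) , (λ e → 2F , sym e) ]′ (Na xy)
      closed (2F , refl) xy = [ (λ e → 1F , sym e) , (λ e → 3F , sym e) ]′ (Nk xy)
      closed (3F , refl) xy = [ (λ e → 0F , sym e) , (λ e → 2F , sym e) ]′ (Nb xy)

      p≁k : ¬ Adj p k
      p≁k pk = [ ≢-sym (adjacent⇒≢ ka) ∘ sym , ≢-sym (adjacent⇒≢ kb) ∘ sym ]′ (Np pk)

      a≁b : ¬ Adj a b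
      a≁b ab = [ ≢-sym (adjacent⇒≢ pb) , ≢-sym (adjacent⇒≢ kb) ]′ (Na ab)

      preserves : ∀ x y → Graph.Adj C₄ x y → Adj (f x) (f y)
      preserves 0F 1F _ = pa
      preserves 0F 3F _ = pb
      preserves 1F 0F _ = symm pa
      preserves 1F 2F _ = symm ka
      preserves 2F 1F _ = ka
      preserves 2F 3F _ = kb
      preserves 3F 0F _ = symm pb
      preserves 3F 2F _ = symm kb
      preserves 0F 0F = ⊥-elim ∘ from-no (Graph.adj? C₄ 0F 0F)
      preserves 0F 2F = ⊥-elim ∘ from-no (Graph.adj? C₄ 0F 2F)
      preserves 1F 1F = ⊥-elim ∘ from-no (Graph.adj? C₄ 1F 1F)
      preserves 1F 3F = ⊥-elim ∘ from-no (Graph.adj? C₄ 1F 3F)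
      preserves 2F 0F = ⊥-elim ∘ from-no (Graph.adj? C₄ 2F 0F)
      preserves 2F 2F = ⊥-elim ∘ from-no (Graph.adj? C₄ 2F 2F)
      preserves 3F 1F = ⊥-elim ∘ from-no (Graph.adj? C₄ 3F 1F)
      preserves 3F 3F = ⊥-elim ∘ from-no (Graph.adj? C₄ 3F 3F)

      reflects : ∀ x y → Adj (f x) (f y) → Graph.Adj C₄ x y
      reflects 0F 1F _ = inj₁ refl
      reflects 0F 3F _ = inj₂ refl
      reflects 1F 0F _ = inj₂ refl
      reflects 1F 2F _ = inj₁ refl
      reflects 2F 1F _ = inj₂ refl
      reflects 2F 3F _ = inj₁ refl
      reflects 3F 0F _ = inj₁ refl
      reflects 3F 2F _ = inj₂ refl
      reflects 0F 0F = ⊥-elim ∘ irrefl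
      reflects 0F 2F = ⊥-elim ∘ p≁k
      reflects 1F 1F = ⊥-elim ∘ irrefl
      reflects 1F 3F = ⊥-elim ∘ a≁b
      reflects 2F 0F = ⊥-elim ∘ p≁k ∘ symm
      reflects 2F 2F = ⊥-elim ∘ irrefl
      reflects 3F 1F = ⊥-elim ∘ a≁b ∘ symm
      reflects 3F 3F = ⊥-elim ∘ irrefl

  module _ {l s} (leaf : Leaf l s) (leaf′ : Leaf s l) where

    -- Here each end is both a leaf and a support, so the edge is handled apart from the graphs
    -- where `exclusive` separates the two kinds.
    edge⇒≅corona : H ≅ corona (K 1)
    edge⇒≅corona = bijection⇒≅ f (lookup-injective distinct)
      (closed⇒all closed (0F , refl)) preserves reflects
      where
      f : Fin 2 → Vertex H
      f = lookup (s ∷ l ∷ [])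

      distinct : Unique (s ∷ l ∷ [])
      distinct = (adjacent⇒≢ (proj₁ leaf′) ∷ []) ∷ [] ∷ []

      closed : ∀ {x y} → ∃[ i ] f i ≡ x → Adj x y → ∃[ i ] f i ≡ y
      closed (0F , refl) xy = 1F , sym (proj₂ leaf′ _ xy)
      closed (1F , refl) xy = 0F , sym (proj₂ leaf _ xy)

      preserves : ∀ x y → Graph.Adj (corona (K 1)) x y → Adj (f x) (f y)
      preserves 0F 0F xy = ⊥-elim (xy refl)
      preserves 0F 1F _  = proj₁ leaf′
      preserves 1F 0F _  = proj₁ leaf

      reflects : ∀ x y → Adj (f x) (f y) → Graph.Adj (corona (K 1)) x y
      reflects 0F 0F = ⊥-elim ∘ irrefl
      reflects 0F 1F _ = refl
      reflects 1F 0F _ = refl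
      reflects 1F 1F = ⊥-elim ∘ irrefl

  module _ (unique : ∀ {l l′ s} → Leaf l s → Leaf l′ s → l ≡ l′)
    (classify : ∀ v → HasLeaf v ⊎ IsLeaf v) (exclusive : ∀ {v} → HasLeaf v → ¬ IsLeaf v) where
    private
      hasLeaf? : Decidable HasLeaf
      hasLeaf? s = any? λ l → leaf? l s

      supports : List (Vertex H)
      supports = filter hasLeaf? (allFin H.order)

      m : ℕ
      m = length supports

      stem : Fin m → Vertex H
      stem = lookup supports

      stem-injective : ∀ {i j} → stem i ≡ stem j → i ≡ j
      stem-injective = lookup-injective (filter⁺ hasLeaf? (allFin⁺ H.order))

      stem-hasLeaf : ∀ i → HasLeaf (stem i)
      stem-hasLeaf i = proj₂ (∈-filter⁻ hasLeaf? {xs = allFin H.order} (∈-lookup i))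

      stem-surjective : ∀ {v} → HasLeaf v → ∃[ i ] stem i ≡ v
      stem-surjective {v} h = Any.index v∈ , sym (lookup-index v∈)
        where v∈ = ∈-filter⁺ hasLeaf? (∈-allFin v) h

      tip : Fin m → Vertex H
      tip i = proj₁ (stem-hasLeaf i)

      tip-leaf : ∀ i → Leaf (tip i) (stem i)
      tip-leaf i = proj₂ (stem-hasLeaf i)

      -- The subgraph induced by the supports; H turns out to be its corona.
      core : Graph
      core = record
        { order  = m
        ; Adj    = λ i j → Adj (stem i) (stem j)
        ; adj?   = λ i j → adj? (stem i) (stem j)
        ; symm   = symm
        ; irrefl = irrefl
        }

      vertex : Fin m ⊎ Fin m → Vertex H
      vertex = [ stem , tip ]′

      vertex-injective : ∀ {s t} → vertex s ≡ vertex t → s ≡ t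
      vertex-injective {inj₁ i} {inj₁ j} eq = cong inj₁ (stem-injective eq)
      vertex-injective {inj₁ i} {inj₂ j} eq = ⊥-elim (exclusive (stem-hasLeaf i)
        (stem j , subst (λ v → Leaf v (stem j)) (sym eq) (tip-leaf j)))
      vertex-injective {inj₂ i} {inj₁ j} eq = ⊥-elim (exclusive (stem-hasLeaf j)
        (stem i , subst (λ v → Leaf v (stem i)) eq (tip-leaf i)))
      vertex-injective {inj₂ i} {inj₂ j} eq = cong inj₂ (stem-injective
        (proj₂ (tip-leaf j) _ (subst (λ v → Adj v (stem i)) eq (proj₁ (tip-leaf i)))))

      vertex-surjective : ∀ v → ∃[ s ] vertex s ≡ v
      vertex-surjective v with classify v
      ... | inj₁ has = let i , eq = stem-surjective has in inj₁ i , eq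
      ... | inj₂ (s , leaf) with i , refl ← stem-surjective (v , leaf) =
        inj₂ i , unique (tip-leaf i) leaf

      vertex-preserves : ∀ s t → CoronaAdj core s t → Adj (vertex s) (vertex t)
      vertex-preserves (inj₁ i) (inj₁ j) ij   = ij
      vertex-preserves (inj₁ i) (inj₂ j) refl = symm (proj₁ (tip-leaf i))
      vertex-preserves (inj₂ i) (inj₁ j) refl = proj₁ (tip-leaf i)

      vertex-reflects : ∀ s t → Adj (vertex s) (vertex t) → CoronaAdj core s t
      vertex-reflects (inj₁ i) (inj₁ j) st = st
      vertex-reflects (inj₁ i) (inj₂ j) st = stem-injective (proj₂ (tip-leaf j) _ (symm st))
      vertex-reflects (inj₂ i) (inj₁ j) st = sym (stem-injective (proj₂ (tip-leaf i) _ st))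
      -- The sole neighbour of a leaf is its support, and no support is a leaf; so two leaves are
      -- never adjacent.
      vertex-reflects (inj₂ i) (inj₂ j) st with () ←
        vertex-injective {inj₂ j} {inj₁ i} (proj₂ (tip-leaf i) _ st)

      -- A walk in H projects to the core by sending each leaf to its support.
      core-connected : Connected core
      core-connected i j = go (inj₁ i) refl (con (stem i) (stem j))
        where
        base : Fin m ⊎ Fin m → Fin m
        base = [ id , id ]′

        step : ∀ s t → CoronaAdj core s t → ∀ {k} → Star (Graph.Adj core) (base t) k →
          Star (Graph.Adj core) (base s) k
        step (inj₁ _) (inj₁ _) st   walk = st ◅ walk
        step (inj₁ _) (inj₂ _) refl walk = walk
        step (inj₂ _) (inj₁ _) refl walk = walk

        go : ∀ s {v} → vertex s ≡ v → Star Adj v (stem j) → Star (Graph.Adj core) (base s) j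
        go s eq ε with refl ← vertex-injective {s} {inj₁ j} eq = ε
        go s refl (_◅_ {j = z} sz walk) with t , refl ← vertex-surjective z =
          step s t (vertex-reflects s t sz) (go t refl walk)

    leaves⇒≅corona : ∃[ F ] Connected F × H ≅ corona F
    leaves⇒≅corona = core , core-connected , bijection⇒≅ (vertex ∘ splitAt m)
      (λ {x} {y} eq → splitAt-injective (vertex-injective eq))
      (λ v → let s , eq = vertex-surjective v
             in join m m s , trans (cong vertex (splitAt-join m m s)) eq)
      (λ x y → vertex-preserves (splitAt m x) (splitAt m y))
      (λ x y → vertex-reflects (splitAt m x) (splitAt m y))
      where
      splitAt-injective : ∀ {x y : Fin (m + m)} → splitAt m x ≡ splitAt m y → x ≡ y
      splitAt-injective {x} {y} eq =
        trans (sym (join-splitAt m m x)) (trans (cong (join m m) eq) (join-splitAt m m y))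

  module _ (only : ∀ {p a b} → a ≢ b → Adj p a → Adj p b → ∃[ k ] Only k a b × k ≢ p) where
    private
      -- For y ≠ l, the neighbours `y` and `l` of `s` yield some k ≠ s with N(k) ⊆ {y , l}. It
      -- cannot be adjacent to `l`, whose only neighbour is `s`; so `k` is a leaf at `y`.
      support-spreads : ∀ {l s y} → Leaf l s → Adj s y →
        y ≡ l ⊎ (∃[ h ] h ≢ s × Leaf h y)
      support-spreads {l} {s} {y} (ls , l-only) sy with y ≟ l
      ... | yes y≡l = inj₁ y≡l
      ... | no  y≢l with k , Nk , k≢s ← only y≢l sy (symm ls) with hasH k
      ...   | z , kz = inj₂ (k , k≢s , subst (Adj k) (k-only z kz) kz , k-only)
        where
        k-only : ∀ z → Adj k z → z ≡ y
        k-only z kz with Nk kz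
        ... | inj₁ z≡y  = z≡y
        ... | inj₂ refl = ⊥-elim (k≢s (l-only k (symm kz)))

      -- A second leaf l′ at `s` would in turn support a leaf h ≠ s, although its only neighbour is
      -- `s`.
      unique-leaf : ∀ {l l′ s} → Leaf l s → Leaf l′ s → l ≡ l′
      unique-leaf leaf (l′s , l′-only) with support-spreads leaf (symm l′s)
      ... | inj₁ l′≡l                   = sym l′≡l
      ... | inj₂ (h , h≢s , hl′ , _) = ⊥-elim (h≢s (l′-only h (symm hl′)))

      leafy : ∀ {x y} → HasLeaf x ⊎ IsLeaf x → Adj x y → HasLeaf y ⊎ IsLeaf y
      leafy (inj₁ (l , leaf)) xy with support-spreads leaf xy
      ... | inj₁ refl              = inj₂ (_ , leaf)
      ... | inj₂ (h , _ , leaf′) = inj₁ (h , leaf′)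
      leafy {x} (inj₂ (s , leaf)) xy with refl ← proj₂ leaf _ xy = inj₁ (x , leaf)

    -- With a leaf, H is a single edge if some vertex is both leaf and support, and otherwise the
    -- corona of its core. Without leaves all degrees are two, and `k` shares the neighbours `a` and
    -- `b` of `p`, which closes the cycle p, a, k, b.
    fourCycleOrCorona : Vertex H → FourCycleOrCorona H
    fourCycleOrCorona p with any? (λ l → any? (leaf? l))
    ... | yes (l , s , leaf) with any? (λ v → any? (λ l → leaf? l v) ×-dec any? (leaf? v))
    ...   | yes (v , (l , leaf) , (t , leaf′))
      with refl ← proj₂ leaf′ l (symm (proj₁ leaf)) =
      inj₂ (K 1 , (λ { 0F 0F → ε }) , edge⇒≅corona leaf leaf′)
    ...   | no ¬both = inj₂ (leaves⇒≅corona unique-leaf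
      (closed⇒all leafy (inj₁ (l , leaf))) (λ has is → ¬both (_ , has , is)))
    fourCycleOrCorona p | no noLeaf = inj₁ (square⇒≅C₄
      (≢-sym k≢p) a≢b pa pb ka kb (degree a≢b pa pb) Nk
      (degree (≢-sym k≢p) (symm pa) (symm ka)) (degree (≢-sym k≢p) (symm pb) (symm kb)))
      where
      open Leafless (λ l s leaf → noLeaf (l , s , leaf))
      degree = degree-two λ a≢b pa pb → let k , Nk , _ = only a≢b pa pb in k , λ {y} → Nk {y}
      nbrs = two p
      a   = proj₁ nbrs
      b   = proj₁ (proj₂ nbrs)
      a≢b = proj₁ (proj₂ (proj₂ nbrs))
      pa  = proj₁ (proj₂ (proj₂ (proj₂ nbrs)))
      pb  = proj₂ (proj₂ (proj₂ (proj₂ nbrs)))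
      k   = proj₁ (only a≢b pa pb)
      Nk : Only k a b
      Nk  = proj₁ (proj₂ (only a≢b pa pb))
      k≢p = proj₂ (proj₂ (only a≢b pa pb))
      ka  = proj₁ (both Nk)
      kb  = proj₂ (both Nk)

-- Two small products, checked by enumeration.

Irredundant : (X : Graph) → VertexSet X → Set
Irredundant X D = ∀ x → x ∈ D → ¬ Dominating X (D - x)

-- Minimality is tested on deletions of single vertices, so each subset costs one pass over the
-- vertices rather than over its own subsets.
counterexample? : ∀ X k → Dec (∃[ D ] (Dominating X D × Irredundant X D) × ¬ ∣ D ∣ ≡ k)
counterexample? X k = anySubset? λ D →
  (dominating? X D ×-dec all? λ x → (x ∈? D) →-dec ¬? (dominating? X (D - x)))
    ×-dec ¬? (∣ D ∣ ℕ.≟ k)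

noCounterexample⇒wellDominated : ∀ X k →
  ¬ (∃[ D ] (Dominating X D × Irredundant X D) × ¬ ∣ D ∣ ≡ k) → WellDominated X
noCounterexample⇒wellDominated X k none D D′ m m′ = trans (size D m) (sym (size D′ m′))
  where
  size : ∀ D → MinimalDominating X D → ∣ D ∣ ≡ k
  size D (dom , min) = decidable-stable (∣ D ∣ ℕ.≟ k) λ ≢k →
    none (D , (dom , λ x x∈D → min (D - x) (x∈p⇒p-x⊂p x∈D)) , ≢k)

-- The product consists of two disjoint 4-cycles, each contributing two vertices: hence the 4.
K₂×C₄-wellDominated : WellDominated (K 2 ×ᴳ C₄)
K₂×C₄-wellDominated =
  noCounterexample⇒wellDominated (K 2 ×ᴳ C₄) 4 (from-no (counterexample? (K 2 ×ᴳ C₄) 4))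

-- The common size 3 is that of a fibre {c} × K₃.
K₃×K₃-wellDominated : WellDominated (K 3 ×ᴳ K 3)
K₃×K₃-wellDominated =
  noCounterexample⇒wellDominated (K 3 ×ᴳ K 3) 3 (from-no (counterexample? (K 3 ×ᴳ K 3) 3))

-- Cardinalities as sums, and invariance of well-domination under isomorphism.

indicator : Bool → ℕ
indicator b = if b then 1 else 0

∣tabulate∣≡sum : ∀ {n} (f : Fin n → Bool) → ∣ Vec.tabulate f ∣ ≡ sum (indicator ∘ f)
∣tabulate∣≡sum {zero}  f = refl
∣tabulate∣≡sum {suc n} f with f zero
... | true  = cong suc (∣tabulate∣≡sum (f ∘ suc))
... | false = ∣tabulate∣≡sum (f ∘ suc)

-- Sums can be reindexed along a bijection and added termwise; `∣pullback∣` and `twice-size` depend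
-- on this.
∣p∣≡sum : ∀ {n} (p : Subset n) → ∣ p ∣ ≡ sum (indicator ∘ Vec.lookup p)
∣p∣≡sum p = trans (cong ∣_∣ (sym (tabulate∘lookup p))) (∣tabulate∣≡sum (Vec.lookup p))

sum-ones : ∀ {n} (f : Fin n → ℕ) → (∀ i → f i ≡ 1) → sum f ≡ n
sum-ones {zero}  f ones = refl
sum-ones {suc n} f ones = cong₂ _+_ (ones zero) (sum-ones (f ∘ suc) (ones ∘ suc))

≅-sym : ∀ {G H} → G ≅ H → H ≅ G
≅-sym {G} {H} i = record
  { bijection = ↔-sym bijection
  ; adjacency = λ x y → mk⇔
      (λ xy → from⇔ (adjacency (from x) (from y))
        (subst₂ (Graph.Adj H) (sym (to-from x)) (sym (to-from y)) xy))
      (λ xy → subst₂ (Graph.Adj H) (to-from x) (to-from y) (to⇔ (adjacency (from x) (from y)) xy))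
  }
  where
  open _≅_ i
  open Equivalence using () renaming (to to to⇔; from to from⇔)
  to-from : ∀ x → to (from x) ≡ x
  to-from = Inverse.strictlyInverseˡ bijection

module _ {G H : Graph} (i : G ≅ H) where
  open _≅_ i

  pullback : VertexSet H → VertexSet G
  pullback S = Vec.tabulate (Vec.lookup S ∘ to)

  ∈-pullback⁺ : ∀ {S x} → to x ∈ S → x ∈ pullback S
  ∈-pullback⁺ {S} {x} ∈S = lookup⇒[]= x _ (trans (lookup∘tabulate _ x) ([]=⇒lookup ∈S))

  ∈-pullback⁻ : ∀ {S x} → x ∈ pullback S → to x ∈ S
  ∈-pullback⁻ {S} {x} x∈ = lookup⇒[]= (to x) S (trans (sym (lookup∘tabulate _ x)) ([]=⇒lookup x∈))

  ∣pullback∣ : ∀ S → ∣ pullback S ∣ ≡ ∣ S ∣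
  ∣pullback∣ S = begin
    ∣ pullback S ∣                 ≡⟨ ∣tabulate∣≡sum (Vec.lookup S ∘ to) ⟩
    sum (indicator ∘ Vec.lookup S ∘ to) ≡⟨ sum-permute (indicator ∘ Vec.lookup S) bijection ⟨
    sum (indicator ∘ Vec.lookup S)      ≡⟨ ∣p∣≡sum S ⟨
    ∣ S ∣                          ∎
    where open ≡-Reasoning

  pullback-dominating : ∀ {S} → Dominating H S → Dominating G (pullback S)
  pullback-dominating {S} dom x with dom (to x)
  ... | inj₁ ∈S = inj₁ (∈-pullback⁺ ∈S)
  ... | inj₂ (y , y∈S , xy) = inj₂ (from y ,
    ∈-pullback⁺ (subst (_∈ S) (sym to-from) y∈S) ,
    Equivalence.from (adjacency x (from y)) (subst (Graph.Adj H (to x)) (sym to-from) xy))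
    where
    to-from : to (from y) ≡ y
    to-from = Inverse.strictlyInverseˡ bijection y

module _ {G H : Graph} (i : G ≅ H) where
  open _≅_ i

  -- A dominating proper subset of the preimage is carried by the inverse isomorphism to a
  -- dominating proper subset of `S`.
  pullback-minimal : ∀ {S} → MinimalDominating H S → MinimalDominating G (pullback i S)
  pullback-minimal {S} (dom , min) = pullback-dominating i dom , λ T (T⊆ , x , x∈ , x∉T) domT →
    min (pullback (≅-sym i) T)
      ( (λ {y} y∈ → subst (_∈ S) (Inverse.strictlyInverseˡ bijection y)
          (∈-pullback⁻ i (T⊆ (∈-pullback⁻ (≅-sym i) y∈))))
      , to x , ∈-pullback⁻ i x∈
      , λ tox∈ → x∉T (subst (_∈ T) (Inverse.strictlyInverseʳ bijection x) (∈-pullback⁻ (≅-sym i) tox∈)))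
      (pullback-dominating (≅-sym i) domT)

wellDominated-resp-≅ : ∀ {G H} → G ≅ H → WellDominated H → WellDominated G
wellDominated-resp-≅ {G} {H} i wd D D′ min min′ = begin
  ∣ D ∣                      ≡⟨ ∣pullback∣ (≅-sym i) D ⟨
  ∣ pullback (≅-sym i) D ∣   ≡⟨ wd _ _ (pullback-minimal (≅-sym i) min) (pullback-minimal (≅-sym i) min′) ⟩
  ∣ pullback (≅-sym i) D′ ∣  ≡⟨ ∣pullback∣ (≅-sym i) D′ ⟩
  ∣ D′ ∣                     ∎
  where open ≡-Reasoning

-- Isomorphisms between direct products.

module _ {G H : Graph} where

  PairAdj : Vertex G × Vertex H → Vertex G × Vertex H → Set
  PairAdj x y = Graph.Adj G (proj₁ x) (proj₁ y) × Graph.Adj H (proj₂ x) (proj₂ y)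

  adjacent⇒pairAdj : ∀ {x y} →
    Graph.Adj (G ×ᴳ H) (uncurry combine x) (uncurry combine y) → PairAdj x y
  adjacent⇒pairAdj {x} {y} =
    subst₂ PairAdj (uncurry remQuot-combine x) (uncurry remQuot-combine y)

  pairAdj⇒adjacent : ∀ {x y} → PairAdj x y →
    Graph.Adj (G ×ᴳ H) (uncurry combine x) (uncurry combine y)
  pairAdj⇒adjacent {x} {y} =
    subst₂ PairAdj (sym (uncurry remQuot-combine x)) (sym (uncurry remQuot-combine y))

module _ (G H G′ H′ : Graph) (φ : (Vertex G × Vertex H) ↔ (Vertex G′ × Vertex H′))
  (adj : ∀ x y → PairAdj {G} {H} x y ⇔ PairAdj {G′} {H′} (Inverse.to φ x) (Inverse.to φ y)) where

  pairs⇒≅ : G ×ᴳ H ≅ G′ ×ᴳ H′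
  pairs⇒≅ = record
    { bijection = ↔-trans (*↔× {order G} {order H}) (↔-trans φ (↔-sym *↔×))
    ; adjacency = λ x y → mk⇔
        (λ xy → pairAdj⇒adjacent {G′} {H′} (Equivalence.to (adj _ _) xy))
        (λ xy → Equivalence.from (adj _ _) (adjacent⇒pairAdj {G′} {H′} xy))
    }

×-cong : ∀ {G G′ H H′} → G ≅ G′ → H ≅ H′ → G ×ᴳ H ≅ G′ ×ᴳ H′
×-cong {G} {G′} {H} {H′} i j = pairs⇒≅ G H G′ H′
  (_≅_.bijection i ×-↔ _≅_.bijection j) λ (g , h) (g′ , h′) → mk⇔
  (Product.map (Equivalence.to (_≅_.adjacency i g g′)) (Equivalence.to (_≅_.adjacency j h h′)))
  (Product.map (Equivalence.from (_≅_.adjacency i g g′)) (Equivalence.from (_≅_.adjacency j h h′)))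

×-comm : ∀ G H → G ×ᴳ H ≅ H ×ᴳ G
×-comm G H = pairs⇒≅ G H H G (mk↔ₛ′ Product.swap Product.swap (λ _ → refl) (λ _ → refl))
  λ x y → mk⇔ Product.swap Product.swap

-- Perfect matchings by pendant edges, and the products of K₂ with coronas.

-- Every matched edge has an end of degree one, so a minimal dominating set
-- contains exactly one of its two ends.
record LeafMatching (X : Graph) : Set where
  field
    partner    : Vertex X → Vertex X
    involutive : ∀ x → partner (partner x) ≡ x
    matched    : ∀ x → Graph.Adj X x (partner x)
    leaf       : ∀ x → (∀ {y} → Graph.Adj X x y → y ≡ partner x) ⊎ (∀ {y} → Graph.Adj X (partner x) y → y ≡ x)

module _ {X : Graph} (M : LeafMatching X) where
  open LeafMatching M

  module _ {D : VertexSet X} (min : MinimalDominating X D) where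

    -- Whatever dominates the end of degree one is one of the two ends.
    one-of-pair : ∀ x → x ∈ D ⊎ partner x ∈ D
    one-of-pair x with leaf x
    ... | inj₁ only with proj₁ min x
    ...   | inj₁ x∈D            = inj₁ x∈D
    ...   | inj₂ (y , y∈D , xy) = inj₂ (subst (_∈ D) (only xy) y∈D)
    one-of-pair x | inj₂ only with proj₁ min (partner x)
    ...   | inj₁ px∈D           = inj₂ px∈D
    ...   | inj₂ (y , y∈D , xy) = inj₁ (subst (_∈ D) (only xy) y∈D)

    -- With both ends in `D` the leaf could be dropped: its partner dominates it, and it dominates
    -- nothing besides itself and its partner, which stays.
    leaf-excludes-partner : ∀ x → (∀ {y} → Graph.Adj X x y → y ≡ partner x) → x ∈ D → partner x ∉ D
    leaf-excludes-partner x only x∈D px∈D = proj₂ min (D - x) (x∈p⇒p-x⊂p x∈D) dom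
      where
      px≢x : partner x ≢ x
      px≢x eq = Graph.irrefl X (subst (Graph.Adj X x) eq (matched x))

      px∈D-x : partner x ∈ D - x
      px∈D-x = x∈p∧x≢y⇒x∈p-y px∈D px≢x

      dom : Dominating X (D - x)
      dom z with z ≟ x
      ... | yes refl = inj₂ (partner x , px∈D-x , matched x)
      ... | no z≢x with proj₁ min z
      ...   | inj₁ z∈D = inj₁ (x∈p∧x≢y⇒x∈p-y z∈D z≢x)
      ...   | inj₂ (y , y∈D , zy) with y ≟ x
      ...     | no  y≢x  = inj₂ (y , x∈p∧x≢y⇒x∈p-y y∈D y≢x , zy)
      ...     | yes refl = inj₁ (subst (_∈ D - x) (sym (only (Graph.symm X zy))) px∈D-x)

    not-both : ∀ x → x ∈ D → partner x ∉ D
    not-both x x∈D px∈D with leaf x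
    ... | inj₁ only = leaf-excludes-partner x only x∈D px∈D
    ... | inj₂ only = leaf-excludes-partner (partner x)
      (λ xy → trans (only xy) (sym (involutive x))) px∈D (subst (_∈ D) (sym (involutive x)) x∈D)

    pair-count : ∀ x → indicator (Vec.lookup D x) + indicator (Vec.lookup D (partner x)) ≡ 1
    pair-count x with Vec.lookup D x in eq | Vec.lookup D (partner x) in eq′
    ... | true  | true  = ⊥-elim (not-both x (lookup⇒[]= x D eq) (lookup⇒[]= (partner x) D eq′))
    ... | true  | false = refl
    ... | false | true  = refl
    ... | false | false = ⊥-elim ([ absent eq , absent eq′ ]′ (one-of-pair x))
      where
      absent : ∀ {y} → Vec.lookup D y ≡ false → y ∉ D
      absent eq y∈D with () ← trans (sym ([]=⇒lookup y∈D)) eq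

    -- Since `partner` permutes the vertices, summing `pair-count` over all of them counts `D`
    -- twice.
    twice-size : 2 * ∣ D ∣ ≡ order X
    twice-size = begin
      2 * ∣ D ∣                        ≡⟨ cong (∣ D ∣ +_) (ℕ.+-identityʳ ∣ D ∣) ⟩
      ∣ D ∣ + ∣ D ∣                    ≡⟨ cong₂ _+_ (∣p∣≡sum D) (trans (∣p∣≡sum D) (sum-permute f τ)) ⟩
      sum f + sum (f ∘ partner)        ≡⟨ ∑-distrib-+ f (f ∘ partner) ⟨
      sum (λ x → f x + f (partner x))  ≡⟨ sum-ones _ pair-count ⟩
      order X                          ∎
      where
      open ≡-Reasoning
      f = indicator ∘ Vec.lookup D
      τ = mk↔ₛ′ partner partner involutive involutive

  leafMatching⇒wellDominated : WellDominated X
  leafMatching⇒wellDominated D D′ min min′ =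
    ℕ.*-cancelˡ-≡ ∣ D ∣ ∣ D′ ∣ 2 (trans (twice-size min) (sym (twice-size min′)))

-- The matched edges are the pendant ones, with the new vertex as the end of degree one.
corona-matching : ∀ F → LeafMatching (corona F)
corona-matching F = record
  { partner    = join m m ∘ Sum.swap ∘ splitAt m
  ; involutive = λ x → trans (cong (join m m ∘ Sum.swap) (split-partner x))
      (trans (cong (join m m) (swap-involutive (splitAt m x))) (join-splitAt m m x))
  ; matched    = λ x → subst (CoronaAdj F (splitAt m x)) (sym (split-partner x))
      (end-matched (splitAt m x))
  ; leaf       = λ x → Sum.map
      (λ only {y} xy → from-ends (only xy))
      (λ only {y} xy → trans
        (from-ends (only (subst (λ s → CoronaAdj F s (splitAt m y)) (split-partner x) xy)))
        (join-splitAt m m x))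
      (end-leaf (splitAt m x))
  }
  where
  m = order F

  split-partner : ∀ x → splitAt m (join m m (Sum.swap (splitAt m x))) ≡ Sum.swap (splitAt m x)
  split-partner x = splitAt-join m m (Sum.swap (splitAt m x))

  from-ends : ∀ {y s} → splitAt m y ≡ s → y ≡ join m m s
  from-ends {y} eq = trans (sym (join-splitAt m m y)) (cong (join m m) eq)

  end-matched : ∀ s → CoronaAdj F s (Sum.swap s)
  end-matched (inj₁ i) = refl
  end-matched (inj₂ i) = refl

  end-leaf : ∀ s →
    (∀ {t} → CoronaAdj F s t → t ≡ Sum.swap s) ⊎ (∀ {t} → CoronaAdj F (Sum.swap s) t → t ≡ s)
  end-leaf (inj₁ i) = inj₂ λ { {inj₁ _} refl → refl }
  end-leaf (inj₂ i) = inj₁ λ { {inj₁ _} refl → refl }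

-- The degree of (c , h) in K₂ × H is that of `h`, so each matched edge of H lifts to two matched
-- edges whose leaf ends lie over its leaf end.
K₂×-matching : ∀ {H} → LeafMatching H → LeafMatching (K 2 ×ᴳ H)
K₂×-matching {H} M = record
  { partner    = uncurry combine ∘ pair ∘ split
  ; involutive = λ x → trans (cong (uncurry combine ∘ pair) (split-pair x))
      (trans (cong (uncurry combine) (pair-involutive (split x))) (combine-remQuot {2} (order H) x))
  ; matched    = λ x → subst (PairAdj {K 2} {H} (split x)) (sym (split-pair x))
      (≢flip (proj₁ (split x)) , matched (proj₂ (split x)))
  ; leaf       = λ x → Sum.map
      (λ only {y} (p , q) → from-pair (cong₂ _,_ (flip-unique p) (only q)))
      (λ only {y} xy →
        let p , q = subst (λ z → PairAdj {K 2} {H} z (split y)) (split-pair x) xy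
        in trans (from-pair (cong₂ _,_ (trans (flip-unique p) (flip-involutive _)) (only q)))
                 (combine-remQuot {2} (order H) x))
      (leaf (proj₂ (split x)))
  }
  where
  open LeafMatching M

  split : Vertex (K 2 ×ᴳ H) → Fin 2 × Vertex H
  split = remQuot {2} (order H)

  flip : Fin 2 → Fin 2
  flip 0F = 1F
  flip 1F = 0F

  flip-involutive : ∀ c → flip (flip c) ≡ c
  flip-involutive 0F = refl
  flip-involutive 1F = refl

  ≢flip : ∀ c → c ≢ flip c
  ≢flip 0F ()
  ≢flip 1F ()

  flip-unique : ∀ {c d} → c ≢ d → d ≡ flip c
  flip-unique {0F} {0F} c≢d = ⊥-elim (c≢d refl)
  flip-unique {0F} {1F} _   = refl
  flip-unique {1F} {0F} _   = refl
  flip-unique {1F} {1F} c≢d = ⊥-elim (c≢d refl)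

  pair : Fin 2 × Vertex H → Fin 2 × Vertex H
  pair = Product.map flip partner

  split-pair : ∀ x → split (uncurry combine (pair (split x))) ≡ pair (split x)
  split-pair x = uncurry remQuot-combine (pair (split x))

  pair-involutive : ∀ x → pair (pair x) ≡ x
  pair-involutive (c , h) = cong₂ _,_ (flip-involutive c) (involutive h)

  from-pair : ∀ {y z} → split y ≡ z → y ≡ uncurry combine z
  from-pair {y} eq = trans (sym (combine-remQuot {2} (order H) y)) (cong (uncurry combine) eq)

K₂×fourCycleOrCorona : ∀ {G H} → G ≅ K 2 → FourCycleOrCorona H → WellDominated (G ×ᴳ H)
K₂×fourCycleOrCorona i (inj₁ j) = wellDominated-resp-≅ (×-cong i j) K₂×C₄-wellDominated
K₂×fourCycleOrCorona i (inj₂ (F , _ , j)) = wellDominated-resp-≅ (×-cong i j)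
  (leafMatching⇒wellDominated (K₂×-matching (corona-matching F)))

-- The second factor, for a complete first factor with at least three or exactly two vertices.

module _ (G H : Graph) (complete : Complete G) (conH : Connected H) (hasH : HasNeighbours H)
  (h₀ : Vertex H) (wd : WellDominated (G ×ᴳ H)) where
  open Leaves H

  -- Besides the vertex carrying the fibre, G has two more, so `independent-exchange` gives |N(T)| ≥
  -- 2|T| for every independent T in H.
  three-vertices⇒K₃×K₃ : 3 ≤ order G → G ≅ K 3 × H ≅ K 3
  three-vertices⇒K₃×K₃ 3≤m = complete⇒≅K complete order≡3 , H≅K₃
    where
    module H = Graph H

    colour : ∀ {k} → k ≤ order G → Fin k → Vertex G
    colour k≤m i = inject≤ i k≤m

    colour-≢ : ∀ {k} (k≤m : k ≤ order G) {i j} → i ≢ j → colour k≤m i ≢ colour k≤m j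
    colour-≢ k≤m i≢j = i≢j ∘ inject≤-injective k≤m k≤m _ _

    open Exchange G H complete hasH wd (colour 3≤m 0F)

    cs : List (Vertex G)
    cs = colour 3≤m 1F ∷ colour 3≤m 2F ∷ []

    !cs : Unique cs
    !cs = (colour-≢ 3≤m {1F} {2F} (λ ()) ∷ []) ∷ [] ∷ []

    c₁∉cs : ¬ (colour 3≤m 0F List.∈ cs)
    c₁∉cs (here eq)         = colour-≢ 3≤m {0F} {1F} (λ ()) eq
    c₁∉cs (there (here eq)) = colour-≢ 3≤m {0F} {2F} (λ ()) eq

    singleton-independent : ∀ {v s t} → s List.∈ (v ∷ []) → t List.∈ (v ∷ []) → ¬ H.Adj s t
    singleton-independent (here refl) (here refl) = H.irrefl

    -- Otherwise the two vertices of `cs` × {l} could replace the single vertex over `s` in the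
    -- fibre.
    noLeaf : ∀ l s → ¬ Leaf l s
    noLeaf l s (_ , only-s) with independent-exchange cs (l ∷ []) (s ∷ []) !cs c₁∉cs ([] ∷ [])
      singleton-independent (λ { (here refl) ly → here (only-s _ ly) })
    ... | s≤s ()

    open Leafless H conH hasH noLeaf

    degree : ∀ {p a b} → a ≢ b → H.Adj p a → H.Adj p b → Only p a b
    degree = degree-two λ a≢b pa pb →
      let k , Nk , _ = dominating-exchange (colour-≢ 3≤m {0F} {1F} (λ ())) a≢b pa pb
      in k , λ {y} → Nk {y}

    p   = h₀
    a   = proj₁ (two p)
    b   = proj₁ (proj₂ (two p))
    a≢b = proj₁ (proj₂ (proj₂ (two p)))
    pa  = proj₁ (proj₂ (proj₂ (proj₂ (two p))))
    pb  = proj₂ (proj₂ (proj₂ (proj₂ (two p))))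

    order≡3 : 3 ≡ order G
    order≡3 = [ ⊥-elim ∘ four-colours , id ]′ (ℕ.m≤n⇒m<n∨m≡n 3≤m)
      where
      -- A fourth vertex of G would let three vertices over `p` replace the two over N(p) = {a , b}.
      four-colours : ¬ (4 ≤ order G)
      four-colours 4≤m with Exchange.independent-exchange G H complete hasH wd (colour 4≤m 0F)
        (colour 4≤m 1F ∷ colour 4≤m 2F ∷ colour 4≤m 3F ∷ []) (p ∷ []) (a ∷ b ∷ [])
        ((colour-≢ 4≤m {1F} {2F} (λ ()) ∷ colour-≢ 4≤m {1F} {3F} (λ ()) ∷ [])
          ∷ (colour-≢ 4≤m {2F} {3F} (λ ()) ∷ []) ∷ [] ∷ [])
        (λ { (here eq)                 → colour-≢ 4≤m {0F} {1F} (λ ()) eq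
           ; (there (here eq))         → colour-≢ 4≤m {0F} {2F} (λ ()) eq
           ; (there (there (here eq))) → colour-≢ 4≤m {0F} {3F} (λ ()) eq })
        ([] ∷ []) singleton-independent
        (λ { (here refl) py → [ here , there ∘ here ]′ (degree a≢b pa pb py) })
      ... | s≤s (s≤s ())

    -- Otherwise the four vertices of cs × {a , b} could replace at most three:
    -- p and the second neighbours of a and b.
    ab : H.Adj a b
    ab = decidable-stable (H.adj? a b) λ a≁b →
      let a′ , a′≢p , aa′ = second (H.symm pa)
          b′ , b′≢p , bb′ = second (H.symm pb)
      in case independent-exchange cs (a ∷ b ∷ []) (p ∷ a′ ∷ b′ ∷ []) !cs c₁∉cs
        ((a≢b ∷ []) ∷ [] ∷ [])
        (λ { (here refl) (here refl) → H.irrefl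
           ; (here refl) (there (here refl)) → a≁b
           ; (there (here refl)) (here refl) → a≁b ∘ H.symm
           ; (there (here refl)) (there (here refl)) → H.irrefl })
        (λ { (here refl) ay → [ here , there ∘ here ]′ (degree (≢-sym a′≢p) (H.symm pa) aa′ ay)
           ; (there (here refl)) by →
               [ here , there ∘ there ∘ here ]′ (degree (≢-sym b′≢p) (H.symm pb) bb′ by) })
      of λ { (s≤s (s≤s (s≤s ()))) }

    H≅K₃ : H ≅ K 3
    H≅K₃ = triangle⇒≅K₃ H conH hasH pa pb ab (degree a≢b pa pb)
      (degree (adjacent⇒≢ pb) (H.symm pa) ab)
      (degree (adjacent⇒≢ pa) (H.symm pb) (H.symm ab))

  -- In `dominating-exchange` the case k = p produces a third vertex of G, so here k ≠ p always.
  two-vertices⇒fourCycleOrCorona : 2 ≡ order G → FourCycleOrCorona H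
  two-vertices⇒fourCycleOrCorona 2≡m = fourCycleOrCorona H conH hasH only h₀
    where
    no-third : ∀ {n} → 2 ≡ n → {x y z : Fin n} → x ≢ y → z ≢ x → ¬ z ≢ y
    no-third refl {0F} {0F}      x≢y _ _   = x≢y refl
    no-third refl {1F} {1F}      x≢y _ _   = x≢y refl
    no-third refl {0F} {1F} {0F} _ z≢x _   = z≢x refl
    no-third refl {0F} {1F} {1F} _ _ z≢y   = z≢y refl
    no-third refl {1F} {0F} {0F} _ _ z≢y   = z≢y refl
    no-third refl {1F} {0F} {1F} _ z≢x _   = z≢x refl

    c₁ c₂ : Vertex G
    c₁ = inject≤ {2} 0F (ℕ.≤-reflexive 2≡m)
    c₂ = inject≤ {2} 1F (ℕ.≤-reflexive 2≡m)

    c₁≢c₂ : c₁ ≢ c₂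
    c₁≢c₂ eq with () ← inject≤-injective (ℕ.≤-reflexive 2≡m) (ℕ.≤-reflexive 2≡m) 0F 1F eq

    only : ∀ {p a b} → a ≢ b → Graph.Adj H p a → Graph.Adj H p b →
      ∃[ k ] Only k a b × k ≢ p
    only a≢b pa pb =
      let k , Nk , k≡p⇒ = Exchange.dominating-exchange G H complete hasH wd c₁ c₁≢c₂ a≢b pa pb
      in k , (λ {y} → Nk {y}) , λ k≡p → let c , c≢c₁ , c≢c₂ = k≡p⇒ k≡p
                                        in no-third 2≡m c₁≢c₂ c≢c₁ c≢c₂

-- The equivalence.

wellDominated⇒ : ∀ G H → Nontrivial G → Nontrivial H → Connected G → Connected H →
  NoIsolatableVertices G → WellDominated (G ×ᴳ H) →
  (G ≅ K 3 × H ≅ K 3) ⊎ (G ≅ K 2 × FourCycleOrCorona H)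
wellDominated⇒ G H ntG ntH conG conH noIso wd = Sum.map
  (three-vertices⇒K₃×K₃ G H complete conH hasH h₀ wd)
  (λ 2≡m → complete⇒≅K complete 2≡m ,
    two-vertices⇒fourCycleOrCorona G H complete conH hasH h₀ wd 2≡m)
  (ℕ.m≤n⇒m<n∨m≡n ntG)
  where
  hasH = connected⇒hasNeighbours {H} ntH conH

  h₀ : Vertex H
  h₀ = inject≤ {2} 0F ntH

  complete : Complete G
  complete = noIsolatable⇒complete {G} {H} h₀ hasH wd noIso conG

theorem3 : (G H : Graph) →
    Nontrivial G → Nontrivial H → Connected G → Connected H →
    NoIsolatableVertices G ⊎ NoIsolatableVertices H →
    WellDominated (G ×ᴳ H) ⇔
    ((G ≅ K 3 × H ≅ K 3)
    ⊎ (G ≅ K 2 × FourCycleOrCorona H)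
    ⊎ (H ≅ K 2 × FourCycleOrCorona G))
theorem3 G H ntG ntH conG conH noIso = mk⇔ (forward noIso) backward
  where
  forward : NoIsolatableVertices G ⊎ NoIsolatableVertices H → WellDominated (G ×ᴳ H) →
    (G ≅ K 3 × H ≅ K 3) ⊎ (G ≅ K 2 × FourCycleOrCorona H) ⊎ (H ≅ K 2 × FourCycleOrCorona G)
  forward (inj₁ noIsoG) wd = Sum.map₂ inj₁ (wellDominated⇒ G H ntG ntH conG conH noIsoG wd)
  -- Commutativity of the product lets the factors exchange roles.
  forward (inj₂ noIsoH) wd = Sum.map Product.swap inj₂
    (wellDominated⇒ H G ntH ntG conH conG noIsoH (wellDominated-resp-≅ (×-comm H G) wd))

  backward : (G ≅ K 3 × H ≅ K 3) ⊎ (G ≅ K 2 × FourCycleOrCorona H) ⊎ (H ≅ K 2 × FourCycleOrCorona G) →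
    WellDominated (G ×ᴳ H)
  backward (inj₁ (i , j))        = wellDominated-resp-≅ (×-cong i j) K₃×K₃-wellDominated
  backward (inj₂ (inj₁ (i , h))) = K₂×fourCycleOrCorona i h
  backward (inj₂ (inj₂ (j , g))) = wellDominated-resp-≅ (×-comm G H) (K₂×fourCycleOrCorona j g)
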